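{- Let $p\geq 5$ be prime, let $A$ be a $k\times n$ matrix over $\mathbb{F}_p$ of rank $k$ with $d_A=d$, and let $b\in\mathbb{F}_p^k$ be such that the system $A\cdot x=b$ has no solution in $\{0,1\}^n$ (i.e. $(A,b)\in ECC_{n,k,d}$). Assume $(A,b)$ is $(s,r)$-robust for some $s<\frac{d}{2}$. Then every BinRegDags$^{(p)}$ refutation of $A\cdot x=b$ has size $2^{\Omega(r)}$, i.e. at least $2^{c\,r}$ nodes for a constant $c>0$ not depending on the instance.
   Context: For $v\in\mathbb{F}_p^n$, $\omega(v)$ is the number of nonzero coordinates of $v$. For a $k\times n$ matrix $A$ over $\mathbb{F}_p$, $d_A:=\min_{y\in\mathbb{F}_p^k,\,y\neq 0}\omega(y\cdot A)$ (the distance of the code generated by $A$). A linear equation $f=a$ ($f$ a linear form, $a\in\mathbb{F}_p$) is identified with the affine polynomial $f-a$; the span $\langle\mathcal{S}\rangle$ of a set of equations is the $\mathbb{F}_p$-linear span of these polynomials, and "$\mathcal{G}\subseteq\langle\mathcal{F}\rangle$" means every equation of $\mathcal{G}$ lies in this span. A system is 0-1 unsatisfiable if it has no solution in $\{0,1\}^n$. For a partial 0-1 assignment $\rho$ (a map from a subset $supp(\rho)$ of the variables to $\{0,1\}$), $\mathcal{G}\restriction_\rho$ is the system obtained by substituting the values of $\rho$. $(s,r)$-robustness: write $A\cdot x=b$ as the set of equations $\mathcal{F}$. Consider all pairs $(\rho,\mathcal{G})$ where $\rho$ is a partial 0-1 assignment with $|supp(\rho)|=s$ and $\mathcal{G}$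 is a system of linear equations such that (1) $\mathcal{G}\subseteq\langle\mathcal{F}\rangle$, (2) $\mathcal{G}\restriction_\rho$ is 0-1 unsatisfiable, (3) the coefficient matrix of $\mathcal{G}$ restricted to the columns indexed by $supp(\rho)$ (denoted $\mathcal{G}_{[supp(\rho)]}$) has no zero column, i.e. depends on all variables in $supp(\rho)$. $(A,b)$ is $(s,r)$-robust if for every such pair the dimension of the span of the rows of $\mathcal{G}_{[supp(\rho)]}$ is at least $r$. BinRegDags$^{(p)}$ refutation of a 0-1 unsatisfiable system $\mathcal{F}$: a dag $T$ with exactly one node of in-degree $0$ (the root) such that every node $v$ is marked with a 0-1 unsatisfiable linear system $\mathcal{F}_v$, the root is marked with $\mathcal{F}$; every node has out-degree $0$ (terminal node) or $2$ (splitting node); a splitting node $v$ is marked with a variable $x_v$ and its two outgoing edges lead to nodes $v_0,v_1$, the edge to $v_b$ marked $x_v=b$ ($b\in\{0,1\}$), with $\langle\mathcal{F}_{v_b}\rangle\subseteq\langle\mathcal{F}_v\rangle\restriction_{x_v\leftarrow b}$; and for every terminal node $v$ the system $\mathcal{F}_v$ has no solution in $\mathbb{F}_p^n$. The size of a refutation is its number of nodes. -}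

module Defs where

open import Data.Nat using (ℕ; zero; suc; _+_; _*_; _∸_; _≤_; _<_; NonZero)
open import Data.Nat.DivMod using (_mod_)
open import Data.Fin using (Fin; toℕ) renaming (zero to fz; suc to fs)
open import Data.Bool using (Bool; true; false)
open import Data.Maybe using (Maybe; just; nothing)
open import Data.List using (List; length; lookup)
open import Data.List.Membership.Propositional using (_∈_)
open import Data.Product using (Σ; ∃; _×_; _,_)
open import Relation.Binary.PropositionalEquality using (_≡_)
open import Relation.Nullary using (¬_; Dec; yes; no)
open import Data.Fin.Properties using (_≟_)

module _ {p : ℕ} .{{_ : NonZero p}} where

  𝔽 : Set
  𝔽 = Fin p

  0F : 𝔽
  0F = 0 mod p

  1F : 𝔽
  1F = 1 mod p

  _+F_ : 𝔽 → 𝔽 → 𝔽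
  a +F b = (toℕ a + toℕ b) mod p

  _*F_ : 𝔽 → 𝔽 → 𝔽
  a *F b = (toℕ a * toℕ b) mod p

  -F_ : 𝔽 → 𝔽
  -F a = (p ∸ toℕ a) mod p

  _-F_ : 𝔽 → 𝔽 → 𝔽
  a -F b = a +F (-F b)

  ΣF : (n : ℕ) → (Fin n → 𝔽) → 𝔽
  ΣF zero f = 0F
  ΣF (suc n) f = f fz +F ΣF n (λ i → f (fs i))

  bit : Bool → 𝔽
  bit true = 1F
  bit false = 0F

  Vecₚ : ℕ → Set
  Vecₚ n = Fin n → 𝔽

  Mat : ℕ → ℕ → Set
  Mat k n = Fin k → Fin n → 𝔽

  ω : {n : ℕ} → Vecₚ n → ℕ
  ω {zero} v = 0
  ω {suc n} v with v fz ≟ 0F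
  ... | yes _ = ω (λ i → v (fs i))
  ... | no  _ = suc (ω (λ i → v (fs i)))

  IsZeroVec : {n : ℕ} → Vecₚ n → Set
  IsZeroVec {n} v = (i : Fin n) → v i ≡ 0F

  _·ᵥ_ : {k n : ℕ} → Vecₚ k → Mat k n → Vecₚ n
  _·ᵥ_ {k} y A j = ΣF k (λ i → y i *F A i j)

  HasRank : {k n : ℕ} → Mat k n → ℕ → Set
  HasRank {k} A r = (r ≡ k) × ((y : Vecₚ k) → IsZeroVec (y ·ᵥ A) → IsZeroVec y)

  Distance : {k n : ℕ} → Mat k n → ℕ → Set
  Distance {k} A d =
    (Σ (Vecₚ k) λ y → (¬ IsZeroVec y) × (ω (y ·ᵥ A) ≡ d)) ×
    ((y : Vecₚ k) → ¬ IsZeroVec y → d ≤ ω (y ·ᵥ A))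

  -- linear equations  Σ coef_i x_i = const, identified with the affine
  -- polynomial Σ coef_i x_i - const

  record Eqn (n : ℕ) : Set where
    constructor eqn
    field
      coef  : Vecₚ n
      const : 𝔽
  open Eqn public

  _≈E_ : {n : ℕ} → Eqn n → Eqn n → Set
  _≈E_ {n} e f = ((i : Fin n) → coef e i ≡ coef f i) × (const e ≡ const f)

  System : ℕ → Set
  System n = List (Eqn n)

  lincomb : {n : ℕ} → (S : System n) → (Fin (length S) → 𝔽) → Eqn n
  lincomb S λs = eqn (λ i → ΣF (length S) (λ j → λs j *F coef (lookup S j) i))
                     (ΣF (length S) (λ j → λs j *F const (lookup S j)))

  _∈⟨_⟩ : {n : ℕ} → Eqn n → System n → Set
  e ∈⟨ S ⟩ = Σ (Fin (length S) → 𝔽) λ λs → lincomb S λs ≈E e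

  _⊆⟨_⟩ : {n : ℕ} → System n → System n → Set
  G ⊆⟨ S ⟩ = ∀ {e} → e ∈ G → e ∈⟨ S ⟩

  Sat : {n : ℕ} → Vecₚ n → Eqn n → Set
  Sat {n} x e = ΣF n (λ i → coef e i *F x i) ≡ const e

  SatSys : {n : ℕ} → Vecₚ n → System n → Set
  SatSys x S = ∀ {e} → e ∈ S → Sat x e

  Unsat01 : {n : ℕ} → System n → Set
  Unsat01 {n} S = (x : Fin n → Bool) → ¬ SatSys (λ i → bit (x i)) S

  UnsatFp : {n : ℕ} → System n → Set
  UnsatFp {n} S = (x : Vecₚ n) → ¬ SatSys x S

  PAssign : ℕ → Set
  PAssign n = Fin n → Maybe Bool

  suppSize : {n : ℕ} → PAssign n → ℕ
  suppSize {zero} ρ = 0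
  suppSize {suc n} ρ with ρ fz
  ... | just _  = suc (suppSize (λ i → ρ (fs i)))
  ... | nothing = suppSize (λ i → ρ (fs i))

  restrict : {n : ℕ} → PAssign n → Eqn n → Eqn n
  restrict {n} ρ e =
    eqn (λ i → keep (ρ i) (coef e i))
        (const e -F ΣF n (λ i → val (ρ i) (coef e i)))
    where
      keep : Maybe Bool → 𝔽 → 𝔽
      keep (just _) c = 0F
      keep nothing  c = c
      val : Maybe Bool → 𝔽 → 𝔽
      val (just b) c = c *F bit b
      val nothing  c = 0F

  restrictSys : {n : ℕ} → PAssign n → System n → System n
  restrictSys ρ S = Data.List.map (restrict ρ) S

  single : {n : ℕ} → Fin n → Bool → PAssign n
  single i b j with i ≟ j
  ... | yes _ = just b
  ... | no  _ = nothing

  _∈⟨_⟩↾_ : {n : ℕ} → Eqn n → System n → PAssign n → Set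
  e ∈⟨ S ⟩↾ ρ = Σ (Eqn _) λ g → (g ∈⟨ S ⟩) × (restrict ρ g ≈E e)

  sysOf : {k n : ℕ} → Mat k n → Vecₚ k → System n
  sysOf {k} A b = Data.List.tabulate {n = k} (λ i → eqn (A i) (b i))

  -- rows of G_[supp ρ] (columns outside supp ρ set to 0)
  colRestrict : {n : ℕ} → PAssign n → Vecₚ n → Vecₚ n
  colRestrict ρ v i with ρ i
  ... | just _  = v i
  ... | nothing = 0F

  InRowSpan : {n : ℕ} → Vecₚ n → List (Vecₚ n) → Set
  InRowSpan {n} v R =
    Σ (Fin (length R) → 𝔽) λ λs →
      (i : Fin n) → ΣF (length R) (λ j → λs j *F lookup R j i) ≡ v i

  LinIndep : {r n : ℕ} → (Fin r → Vecₚ n) → Set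
  LinIndep {r} {n} u =
    (λs : Fin r → 𝔽) →
      ((i : Fin n) → ΣF r (λ j → λs j *F u j i) ≡ 0F) →
      (j : Fin r) → λs j ≡ 0F

  DimAtLeast : {n : ℕ} → List (Vecₚ n) → ℕ → Set
  DimAtLeast {n} R r =
    Σ (Fin r → Vecₚ n) λ u → LinIndep u × ((j : Fin r) → InRowSpan (u j) R)

  DependsOnSupp : {n : ℕ} → PAssign n → System n → Set
  DependsOnSupp {n} ρ G =
    (i : Fin n) → (b : Bool) → ρ i ≡ just b →
      Σ (Eqn n) λ g → (g ∈ G) × (¬ (coef g i ≡ 0F))

  Robust : {k n : ℕ} → Mat k n → Vecₚ k → ℕ → ℕ → Set
  Robust {k} {n} A b s r =
    (ρ : PAssign n) → (G : System n) →
      suppSize ρ ≡ s →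
      G ⊆⟨ sysOf A b ⟩ →
      Unsat01 (restrictSys ρ G) →
      DependsOnSupp ρ G →
      DimAtLeast (Data.List.map (λ g → colRestrict ρ (coef g)) G) r

  -- BinRegDags^(p) refutations.
  -- Nodes are Fin N (N = size), the root is node 0, and edges go from a
  -- node to nodes of strictly larger index (a topological numbering,
  -- which every finite dag admits); this guarantees acyclicity.

  data NodeKind {n N : ℕ} (v : Fin N) : Set where
    terminal : NodeKind v
    split    : (x : Fin n) → (c₀ c₁ : Fin N) →
               toℕ v < toℕ c₀ → toℕ v < toℕ c₁ → NodeKind v

  ChildOf : {n N : ℕ} {v : Fin N} → NodeKind {n} v → Fin N → Set
  ChildOf terminal u = Data.Empty.⊥
    where import Data.Empty
  ChildOf (split x c₀ c₁ _ _) u = (u ≡ c₀) Data.Sum.⊎ (u ≡ c₁)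
    where import Data.Sum

  record BinRegDag (n : ℕ) (F : System n) (N : ℕ) : Set where
    field
      root     : Fin N
      rootZero : toℕ root ≡ 0
      label    : Fin N → System n
      kind     : (v : Fin N) → NodeKind {n} v
      rootLab  : label root ≡ F
      hasParent : (u : Fin N) → ¬ (u ≡ root) →
                  Σ (Fin N) λ v → ChildOf (kind v) u
      unsat01  : (v : Fin N) → Unsat01 (label v)
      termUnsat : (v : Fin N) → kind v ≡ terminal → UnsatFp (label v)
      splitOK  : (v : Fin N) (x : Fin n) (c₀ c₁ : Fin N)
                 (l₀ : toℕ v < toℕ c₀) (l₁ : toℕ v < toℕ c₁) →
                 kind v ≡ split x c₀ c₁ l₀ l₁ →
                 (∀ {e} → e ∈⟨ label c₀ ⟩ → e ∈⟨ label v ⟩↾ single x false) ×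
                 (∀ {e} → e ∈⟨ label c₁ ⟩ → e ∈⟨ label v ⟩↾ single x true)

{-# OPTIONS --safe #-}

-- Every total assignment α defines a walk from the root. Along it we keep a set S of variables such that the
-- label of the current node v is the restriction by α on S of equations y·A = y·b, and such that every variable
-- of S occurs in one of these equations: after a query, variables that no longer occur are dropped from S, so S
-- grows by at most one element per step. While |S| < d the rows of A stay independent after restriction, hence
-- the label is solvable over 𝔽_p and v is not terminal; so every walk reaches a node with |S| = s. If the walks
-- of α and β stop at the same v, two lifts of an equation of v differ by a codeword of weight at most 2s < d,
-- so the lifts coincide and α, β satisfy the same equations on S. By robustness r of these are independent, and
-- such a system has at most 2^(n-r) solutions in {0,1}^n. Hence 2^n ≤ N · 2^(n-r).
module Submission where

open import Defs
open import Data.Nat using (ℕ; zero; suc; _+_; _*_; _∸_; _^_; _≤_; _<_; z≤n; s≤s; NonZero; >-nonZero⁻¹; nonTrivial⇒n>1; ≢-nonZero)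
open import Data.Nat.Primality using (Prime; prime⇒nonTrivial)
open import Data.Product using (Σ; ∃; _×_; _,_; proj₁; proj₂)
open import Defs using () renaming (_+F_ to infixl 6 _⊕_; _*F_ to infixl 7 _⊗_; _-F_ to infixl 6 _⊖_; -F_ to infix 8 ⊖_)
import Data.Nat.Properties as ℕ
open import Data.Nat.DivMod using (_mod_; _%_; m<n⇒m%n≡m; n%n≡0; %-distribˡ-+; %-distribˡ-*; [m+kn]%n≡m%n)
open import Data.Nat.Coprimality using (prime⇒coprime; coprime-Bézout)
open import Data.Nat.GCD using (module Bézout)
open import Data.Fin using (Fin; toℕ; punchIn; punchOut) renaming (zero to fz; suc to fs)
open import Data.Fin.Properties using (toℕ-injective; toℕ-fromℕ<; toℕ<n; _≟_; all?; any?; punchIn-punchOut)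
open import Data.Fin.Subset using (Subset; ∣_∣; _∪_; _∩_; ⁅_⁆; ⊥)
open import Data.Fin.Subset.Properties using (x∈⁅x⁆; x∈⁅y⁆⇒x≡y; ∣⁅x⁆∣≡1; ∣⊥∣≡0; ∣p∩q∣≤∣p∣)
open import Data.Bool using (Bool; true; false; T; _∨_; _∧_; if_then_else_)
open import Data.Maybe using (Maybe; just; nothing)
open import Data.Unit using (tt)
open import Data.Sum using (_⊎_; inj₁; inj₂)
open import Data.List using (List; length; lookup; tabulate; map)
open import Data.List.Membership.Propositional using (_∈_)
open import Data.List.Membership.Propositional.Properties using (∈-lookup; ∈-tabulate⁺; ∈-tabulate⁻; ∈-map⁺; ∈-map⁻)
open import Data.List.Relation.Unary.Any using (index)
open import Data.List.Relation.Unary.Any.Properties using (lookup-index)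
open import Data.Vec as Vec using (Vec; []; _∷_)
open import Data.Vec.Properties using (lookup-zipWith; lookup-replicate; lookup∘tabulate; []=⇒lookup; lookup⇒[]=)
open import Data.Vec.Functional using (insertAt)
open import Data.Vec.Functional.Properties using (insertAt-lookup; insertAt-punchIn)
open import Algebra.Bundles using (CommutativeSemiring)
open import Algebra.Structures.Biased using (IsCommutativeSemiringˡ)
open import Algebra.Properties.CommutativeMonoid.Sum ℕ.+-0-commutativeMonoid using (sum; ∑-distrib-+)
open import Function using (_∘_)
open import Relation.Nullary using (¬_; Dec; yes; no; contradiction; ¬?)
open import Relation.Nullary.Decidable using (⌊_⌋; toWitness; decidable-stable)
open import Relation.Binary.PropositionalEquality

-- The field 𝔽_p and column elimination

module _ {p : ℕ} .{{_ : NonZero p}} where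

  toℕ-mod : (m : ℕ) → toℕ (m mod p) ≡ m % p
  toℕ-mod m = toℕ-fromℕ< _

  mod-cong : {m n : ℕ} → m % p ≡ n % p → m mod p ≡ n mod p
  mod-cong eq = toℕ-injective (trans (toℕ-mod _) (trans eq (sym (toℕ-mod _))))

  mod-toℕ : (a : Fin p) → toℕ a mod p ≡ a
  mod-toℕ a = toℕ-injective (trans (toℕ-mod (toℕ a)) (m<n⇒m%n≡m (toℕ<n a)))

  ⊕-mod : (m n : ℕ) → (m mod p) ⊕ (n mod p) ≡ (m + n) mod p
  ⊕-mod m n = mod-cong (trans (cong₂ (λ x y → (x + y) % p) (toℕ-mod m) (toℕ-mod n))
    (sym (%-distribˡ-+ m n p)))

  ⊗-mod : (m n : ℕ) → (m mod p) ⊗ (n mod p) ≡ (m * n) mod p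
  ⊗-mod m n = mod-cong (trans (cong₂ (λ x y → (x * y) % p) (toℕ-mod m) (toℕ-mod n))
    (sym (%-distribˡ-* m n p)))

  -- Every element is the residue of its own representative, so a ring law of `Fin p` has to be
  -- checked on residues of naturals only, where it follows from the law in ℕ.
  mod-elim₃ : (f g : Fin p → Fin p → Fin p → Fin p) →
    ((l m n : ℕ) → f (l mod p) (m mod p) (n mod p) ≡ g (l mod p) (m mod p) (n mod p)) →
    (a b c : Fin p) → f a b c ≡ g a b c
  mod-elim₃ f g eq a b c =
    subst (λ c → f a b c ≡ g a b c) (mod-toℕ c)
    (subst (λ b → f a b _ ≡ g a b _) (mod-toℕ b)
    (subst (λ a → f a _ _ ≡ g a _ _) (mod-toℕ a) (eq (toℕ a) (toℕ b) (toℕ c))))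

  ⊕-assoc : (a b c : Fin p) → (a ⊕ b) ⊕ c ≡ a ⊕ (b ⊕ c)
  ⊕-assoc = mod-elim₃ (λ a b c → (a ⊕ b) ⊕ c) (λ a b c → a ⊕ (b ⊕ c)) λ l m n → begin
    ((l mod p) ⊕ (m mod p)) ⊕ (n mod p) ≡⟨ cong (_⊕ (n mod p)) (⊕-mod l m) ⟩
    ((l + m) mod p) ⊕ (n mod p)          ≡⟨ ⊕-mod (l + m) n ⟩
    (l + m + n) mod p                     ≡⟨ cong (_mod p) (ℕ.+-assoc l m n) ⟩
    (l + (m + n)) mod p                   ≡⟨ ⊕-mod l (m + n) ⟨
    (l mod p) ⊕ ((m + n) mod p)          ≡⟨ cong ((l mod p) ⊕_) (⊕-mod m n) ⟨
    (l mod p) ⊕ ((m mod p) ⊕ (n mod p)) ∎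
    where open ≡-Reasoning

  ⊗-assoc : (a b c : Fin p) → (a ⊗ b) ⊗ c ≡ a ⊗ (b ⊗ c)
  ⊗-assoc = mod-elim₃ (λ a b c → (a ⊗ b) ⊗ c) (λ a b c → a ⊗ (b ⊗ c)) λ l m n → begin
    ((l mod p) ⊗ (m mod p)) ⊗ (n mod p) ≡⟨ cong (_⊗ (n mod p)) (⊗-mod l m) ⟩
    ((l * m) mod p) ⊗ (n mod p)          ≡⟨ ⊗-mod (l * m) n ⟩
    (l * m * n) mod p                     ≡⟨ cong (_mod p) (ℕ.*-assoc l m n) ⟩
    (l * (m * n)) mod p                   ≡⟨ ⊗-mod l (m * n) ⟨
    (l mod p) ⊗ ((m * n) mod p)          ≡⟨ cong ((l mod p) ⊗_) (⊗-mod m n) ⟨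
    (l mod p) ⊗ ((m mod p) ⊗ (n mod p)) ∎
    where open ≡-Reasoning

  ⊕-comm : (a b : Fin p) → a ⊕ b ≡ b ⊕ a
  ⊕-comm a b = cong (_mod p) (ℕ.+-comm (toℕ a) (toℕ b))

  ⊗-comm : (a b : Fin p) → a ⊗ b ≡ b ⊗ a
  ⊗-comm a b = cong (_mod p) (ℕ.*-comm (toℕ a) (toℕ b))

  ⊕-identityˡ : (a : Fin p) → 0F ⊕ a ≡ a
  ⊕-identityˡ a = trans (cong (0F ⊕_) (sym (mod-toℕ a))) (trans (⊕-mod 0 (toℕ a)) (mod-toℕ a))

  ⊗-identityˡ : (a : Fin p) → 1F ⊗ a ≡ a
  ⊗-identityˡ a = trans (cong (1F ⊗_) (sym (mod-toℕ a)))
    (trans (⊗-mod 1 (toℕ a)) (trans (cong (_mod p) (ℕ.*-identityˡ (toℕ a))) (mod-toℕ a)))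

  ⊗-zeroˡ : (a : Fin p) → 0F ⊗ a ≡ 0F
  ⊗-zeroˡ a = trans (cong (0F ⊗_) (sym (mod-toℕ a))) (⊗-mod 0 (toℕ a))

  ⊗-distribʳ : (c a b : Fin p) → (a ⊕ b) ⊗ c ≡ (a ⊗ c) ⊕ (b ⊗ c)
  ⊗-distribʳ = mod-elim₃ (λ c a b → (a ⊕ b) ⊗ c) (λ c a b → a ⊗ c ⊕ b ⊗ c) λ n l m → begin
    ((l mod p) ⊕ (m mod p)) ⊗ (n mod p)                   ≡⟨ cong (_⊗ (n mod p)) (⊕-mod l m) ⟩
    ((l + m) mod p) ⊗ (n mod p)                            ≡⟨ ⊗-mod (l + m) n ⟩
    ((l + m) * n) mod p                                     ≡⟨ cong (_mod p) (ℕ.*-distribʳ-+ n l m) ⟩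
    (l * n + m * n) mod p                                   ≡⟨ ⊕-mod (l * n) (m * n) ⟨
    ((l * n) mod p) ⊕ ((m * n) mod p)                      ≡⟨ cong₂ _⊕_ (⊗-mod l n) (⊗-mod m n) ⟨
    ((l mod p) ⊗ (n mod p)) ⊕ ((m mod p) ⊗ (n mod p))    ∎
    where open ≡-Reasoning

  𝔽-commutativeSemiring : CommutativeSemiring _ _
  𝔽-commutativeSemiring = record
    { isCommutativeSemiring = IsCommutativeSemiringˡ.isCommutativeSemiring record
      { +-isCommutativeMonoid = record
        { isMonoid = record
          { isSemigroup = record
            { isMagma = isMagma _⊕_
            ; assoc = ⊕-assoc }
          ; identity = ⊕-identityˡ , λ a → trans (⊕-comm a 0F) (⊕-identityˡ a) }
        ; comm = ⊕-comm }
      ; *-isCommutativeMonoid = record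
        { isMonoid = record
          { isSemigroup = record
            { isMagma = isMagma _⊗_
            ; assoc = ⊗-assoc }
          ; identity = ⊗-identityˡ , λ a → trans (⊗-comm a 1F) (⊗-identityˡ a) }
        ; comm = ⊗-comm }
      ; distribʳ = ⊗-distribʳ
      ; zeroˡ = ⊗-zeroˡ } }
    where open import Relation.Binary.PropositionalEquality.Algebra using (isMagma)

  open CommutativeSemiring 𝔽-commutativeSemiring public using ()
    renaming (+-identityʳ to ⊕-identityʳ; zeroʳ to ⊗-zeroʳ; *-identityʳ to ⊗-identityʳ; distribˡ to ⊗-distribˡ)

  open import Algebra.Solver.Ring.NaturalCoefficients.Default 𝔽-commutativeSemiring
    using (solve; _:=_; _:+_; _:*_)

  ⊕-inverseʳ : (a : Fin p) → a ⊕ (⊖ a) ≡ 0F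
  ⊕-inverseʳ a = begin
    a ⊕ (⊖ a)                              ≡⟨ cong (_⊕ (⊖ a)) (mod-toℕ a) ⟨
    (toℕ a mod p) ⊕ ((p ∸ toℕ a) mod p)     ≡⟨ ⊕-mod (toℕ a) (p ∸ toℕ a) ⟩
    (toℕ a + (p ∸ toℕ a)) mod p              ≡⟨ cong (_mod p) (ℕ.m+[n∸m]≡n (ℕ.<⇒≤ (toℕ<n a))) ⟩
    p mod p                                  ≡⟨ mod-cong (trans (n%n≡0 p) (sym (m<n⇒m%n≡m (>-nonZero⁻¹ p)))) ⟩
    0F                                       ∎
    where open ≡-Reasoning

  ⊕-cancelˡ : (a : Fin p) {b c : Fin p} → a ⊕ b ≡ a ⊕ c → b ≡ c
  ⊕-cancelˡ a {b} {c} eq = trans (sym (shift b)) (trans (cong ((⊖ a) ⊕_) eq) (shift c))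
    where
    shift : (b : Fin p) → (⊖ a) ⊕ (a ⊕ b) ≡ b
    shift b = begin
      (⊖ a) ⊕ (a ⊕ b)   ≡⟨ solve 3 (λ n a b → n :+ (a :+ b) := (a :+ n) :+ b) refl (⊖ a) a b ⟩
      (a ⊕ (⊖ a)) ⊕ b   ≡⟨ cong (_⊕ b) (⊕-inverseʳ a) ⟩
      0F ⊕ b              ≡⟨ ⊕-identityˡ b ⟩
      b                    ∎
      where open ≡-Reasoning

  ≡⊕⇒≡⊖ : {a b c : Fin p} → a ≡ b ⊕ c → b ≡ a ⊖ c
  ≡⊕⇒≡⊖ {a} {b} {c} eq = begin
    b                    ≡⟨ ⊕-identityʳ b ⟨
    b ⊕ 0F              ≡⟨ cong (b ⊕_) (⊕-inverseʳ c) ⟨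
    b ⊕ (c ⊖ c)        ≡⟨ ⊕-assoc b c (⊖ c) ⟨
    (b ⊕ c) ⊖ c        ≡⟨ cong (_⊖ c) eq ⟨
    a ⊖ c               ∎
    where open ≡-Reasoning

  ⊖-⊕-cancel : (a b : Fin p) → (a ⊖ b) ⊕ b ≡ a
  ⊖-⊕-cancel a b = begin
    (a ⊖ b) ⊕ b    ≡⟨ solve 3 (λ a b n → (a :+ n) :+ b := a :+ (b :+ n)) refl a b (⊖ b) ⟩
    a ⊕ (b ⊖ b)    ≡⟨ cong (a ⊕_) (⊕-inverseʳ b) ⟩
    a ⊕ 0F          ≡⟨ ⊕-identityʳ a ⟩
    a                ∎
    where open ≡-Reasoning

  1F≢0F : Prime p → ¬ (1F ≡ 0F)
  1F≢0F pr eq = ℕ.1+n≢0 (trans (sym (toℕ-small 1 (nonTrivial⇒n>1 p {{prime⇒nonTrivial pr}})))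
      (trans (cong toℕ eq) (toℕ-small 0 (>-nonZero⁻¹ p))))
    where
    toℕ-small : (m : ℕ) → m < p → toℕ (m mod p) ≡ m
    toℕ-small m m<p = trans (toℕ-mod m) (m<n⇒m%n≡m m<p)

  -- The representative of `a` is positive and below the prime `p`, hence coprime to it, and a
  -- Bézout identity supplies the inverse. Over ℕ the identity comes in two forms, according to
  -- which side carries the 1.
  ≢0F⇒invertible : Prime p → (a : Fin p) → ¬ (a ≡ 0F) → ∃ λ b → a ⊗ b ≡ 1F
  ≢0F⇒invertible pr a a≢0 with coprime-Bézout (prime⇒coprime pr {{toℕ≢0}} (toℕ<n a))
    where
    toℕ≢0 : NonZero (toℕ a)
    toℕ≢0 = ≢-nonZero (λ eq → a≢0 (trans (sym (mod-toℕ a)) (cong (_mod p) eq)))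
  ... | Bézout.-+ x y eq = y mod p , (begin
      a ⊗ (y mod p)                        ≡⟨ cong (_⊗ (y mod p)) (mod-toℕ a) ⟨
      (toℕ a mod p) ⊗ (y mod p)            ≡⟨ ⊗-mod (toℕ a) y ⟩
      (toℕ a * y) mod p                     ≡⟨ cong (_mod p) (trans (ℕ.*-comm (toℕ a) y) (sym eq)) ⟩
      (1 + x * p) mod p                     ≡⟨ mod-cong ([m+kn]%n≡m%n 1 x p) ⟩
      1F                                    ∎)
    where open ≡-Reasoning
  -- Here `1 + y * toℕ a ≡ x * p`, so the inverse is minus `y`. Adding `a ⊗ y` to both sides turns
  -- the claim into this identity modulo `p`.
  ... | Bézout.+- x y eq = (⊖ (y mod p)) , ⊕-cancelˡ (a ⊗ (y mod p)) (begin
      (a ⊗ (y mod p)) ⊕ (a ⊗ (⊖ (y mod p)))   ≡⟨ ⊗-distribˡ a (y mod p) (⊖ (y mod p)) ⟨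
      a ⊗ ((y mod p) ⊖ (y mod p))               ≡⟨ cong (a ⊗_) (⊕-inverseʳ (y mod p)) ⟩
      a ⊗ 0F                                     ≡⟨ ⊗-zeroʳ a ⟩
      0F                                          ≡⟨ mod-cong ([m+kn]%n≡m%n 0 x p) ⟨
      (x * p) mod p                               ≡⟨ cong (_mod p) (trans (sym eq) (ℕ.+-comm 1 _)) ⟩
      (y * toℕ a + 1) mod p                       ≡⟨ ⊕-mod (y * toℕ a) 1 ⟨
      ((y * toℕ a) mod p) ⊕ 1F                   ≡⟨ cong (λ t → (t mod p) ⊕ 1F) (ℕ.*-comm y (toℕ a)) ⟩
      ((toℕ a * y) mod p) ⊕ 1F                   ≡⟨ cong (_⊕ 1F) (⊗-mod (toℕ a) y) ⟨
      ((toℕ a mod p) ⊗ (y mod p)) ⊕ 1F          ≡⟨ cong (λ t → (t ⊗ (y mod p)) ⊕ 1F) (mod-toℕ a) ⟩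
      (a ⊗ (y mod p)) ⊕ 1F                      ∎)
    where open ≡-Reasoning

  -- Finite sums and the dot product

  ΣF-cong : {n : ℕ} {f g : Fin n → Fin p} → (∀ i → f i ≡ g i) → ΣF n f ≡ ΣF n g
  ΣF-cong {zero}  eq = refl
  ΣF-cong {suc n} eq = cong₂ _⊕_ (eq fz) (ΣF-cong (λ i → eq (fs i)))

  ΣF-zero : {n : ℕ} {f : Fin n → Fin p} → (∀ i → f i ≡ 0F) → ΣF n f ≡ 0F
  ΣF-zero {zero}  eq = refl
  ΣF-zero {suc n} eq = trans (cong₂ _⊕_ (eq fz) (ΣF-zero (λ i → eq (fs i)))) (⊕-identityˡ 0F)

  ΣF-+ : {n : ℕ} (f g : Fin n → Fin p) → ΣF n (λ i → f i ⊕ g i) ≡ ΣF n f ⊕ ΣF n g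
  ΣF-+ {zero}  f g = sym (⊕-identityˡ 0F)
  ΣF-+ {suc n} f g = trans (cong (f fz ⊕ g fz ⊕_) (ΣF-+ (f ∘ fs) (g ∘ fs)))
    (solve 4 (λ a b c d → (a :+ b) :+ (c :+ d) := (a :+ c) :+ (b :+ d)) refl
      (f fz) (g fz) (ΣF n (f ∘ fs)) (ΣF n (g ∘ fs)))

  ΣF-*ˡ : {n : ℕ} (c : Fin p) (f : Fin n → Fin p) → ΣF n (λ i → c ⊗ f i) ≡ c ⊗ ΣF n f
  ΣF-*ˡ {zero}  c f = sym (⊗-zeroʳ c)
  ΣF-*ˡ {suc n} c f = trans (cong (c ⊗ f fz ⊕_) (ΣF-*ˡ c (f ∘ fs))) (sym (⊗-distribˡ c (f fz) (ΣF n (f ∘ fs))))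

  ΣF-swap : {m n : ℕ} (f : Fin m → Fin n → Fin p) →
    ΣF m (λ i → ΣF n (f i)) ≡ ΣF n (λ j → ΣF m (λ i → f i j))
  ΣF-swap {zero} {n} f = sym (ΣF-zero {n} (λ _ → refl))
  ΣF-swap {suc m} {n} f = trans (cong (ΣF n (f fz) ⊕_) (ΣF-swap (f ∘ fs)))
    (sym (ΣF-+ (f fz) (λ j → ΣF m (λ i → f (fs i) j))))

  ΣF-punchIn : {n : ℕ} (j : Fin (suc n)) (f : Fin (suc n) → Fin p) →
    ΣF (suc n) f ≡ f j ⊕ ΣF n (λ i → f (punchIn j i))
  ΣF-punchIn fz f = refl
  ΣF-punchIn {suc n} (fs j) f = trans (cong (f fz ⊕_) (ΣF-punchIn j (λ i → f (fs i))))
    (solve 3 (λ a b c → a :+ (b :+ c) := b :+ (a :+ c)) refl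
      (f fz) (f (fs j)) (ΣF n (λ i → f (fs (punchIn j i)))))

  infix 9 _∙_
  _∙_ : {n : ℕ} → Vecₚ {p} n → Vecₚ {p} n → Fin p
  _∙_ {n} u x = ΣF n (λ i → u i ⊗ x i)

  ∙-congˡ : {n : ℕ} {u v : Vecₚ {p} n} (x : Vecₚ {p} n) → (∀ i → u i ≡ v i) → u ∙ x ≡ v ∙ x
  ∙-congˡ x eq = ΣF-cong (λ i → cong (_⊗ x i) (eq i))

  ∙-congʳ : {n : ℕ} (u : Vecₚ {p} n) {x y : Vecₚ {p} n} → (∀ i → x i ≡ y i) → u ∙ x ≡ u ∙ y
  ∙-congʳ u eq = ΣF-cong (λ i → cong (u i ⊗_) (eq i))

  ∙-+ˡ : {n : ℕ} (u v x : Vecₚ {p} n) → (λ i → u i ⊕ v i) ∙ x ≡ u ∙ x ⊕ v ∙ x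
  ∙-+ˡ u v x = trans (ΣF-cong (λ i → ⊗-distribʳ (x i) (u i) (v i))) (ΣF-+ (λ i → u i ⊗ x i) (λ i → v i ⊗ x i))

  ∙-+ʳ : {n : ℕ} (u x y : Vecₚ {p} n) → u ∙ (λ i → x i ⊕ y i) ≡ u ∙ x ⊕ u ∙ y
  ∙-+ʳ u x y = trans (ΣF-cong (λ i → ⊗-distribˡ (u i) (x i) (y i))) (ΣF-+ (λ i → u i ⊗ x i) (λ i → u i ⊗ y i))

  ∙-*ˡ : {n : ℕ} (c : Fin p) (u x : Vecₚ {p} n) → (λ i → c ⊗ u i) ∙ x ≡ c ⊗ u ∙ x
  ∙-*ˡ c u x = trans (ΣF-cong (λ i → ⊗-assoc c (u i) (x i))) (ΣF-*ˡ c (λ i → u i ⊗ x i))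

  -- Exchanging the two sums gives (yM)x = y(Mx). An entry of `y ·ᵥ M` is by definition a dot
  -- product with a column, so taking a column of a matrix for `x` yields associativity of matrix
  -- products as well.
  ·ᵥ-∙ : {k n : ℕ} (y : Vecₚ {p} k) (M : Mat {p} k n) (x : Vecₚ {p} n) →
    (y ·ᵥ M) ∙ x ≡ y ∙ (λ i → M i ∙ x)
  ·ᵥ-∙ {k} {n} y M x = begin
    ΣF n (λ j → ΣF k (λ i → y i ⊗ M i j) ⊗ x j)      ≡⟨ ΣF-cong (λ j → ∙-*ʳ j) ⟩
    ΣF n (λ j → ΣF k (λ i → y i ⊗ (M i j ⊗ x j)))    ≡⟨ ΣF-swap (λ j i → y i ⊗ (M i j ⊗ x j)) ⟩
    ΣF k (λ i → ΣF n (λ j → y i ⊗ (M i j ⊗ x j)))    ≡⟨ ΣF-cong (λ i → ΣF-*ˡ (y i) (λ j → M i j ⊗ x j)) ⟩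
    ΣF k (λ i → y i ⊗ M i ∙ x)                        ∎
    where
    open ≡-Reasoning
    ∙-*ʳ : ∀ j → ΣF k (λ i → y i ⊗ M i j) ⊗ x j ≡ ΣF k (λ i → y i ⊗ (M i j ⊗ x j))
    ∙-*ʳ j = trans (⊗-comm ((y ·ᵥ M) j) (x j)) (trans (sym (ΣF-*ˡ (x j) (λ i → y i ⊗ M i j)))
      (ΣF-cong (λ i → solve 3 (λ x y m → x :* (y :* m) := y :* (m :* x)) refl (x j) (y i) (M i j))))

  -- Gaussian elimination, one column at a time

  tails : {r n : ℕ} → Mat {p} r (suc n) → Mat {p} r n
  tails U i l = U i (fs l)

  -- `punchIn j` runs through the rows other than the pivot row `j`. The multipliers `c` are
  -- arbitrary here; `Cancels` says that they clear the first column, which is what justifies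
  -- forgetting it.
  eliminate : {r n : ℕ} → Mat {p} (suc r) (suc n) → Fin (suc r) → (Fin r → Fin p) → Mat {p} r n
  eliminate U j c i l = tails U (punchIn j i) l ⊕ c i ⊗ tails U j l

  Cancels : {r n : ℕ} → Mat {p} (suc r) (suc n) → Fin (suc r) → (Fin r → Fin p) → Set
  Cancels {r} U j c = (i : Fin r) → U (punchIn j i) fz ⊕ c i ⊗ U j fz ≡ 0F

  -- By `Cancels` the first coordinate of `x` enters the combined row with coefficient 0, so
  -- evaluating on the tail of `x` loses nothing.
  eliminate-∙ : {r n : ℕ} (U : Mat {p} (suc r) (suc n)) (j : Fin (suc r)) (c : Fin r → Fin p) → Cancels U j c →
    (x : Vecₚ {p} (suc n)) (i : Fin r) →
    eliminate U j c i ∙ (x ∘ fs) ≡ U (punchIn j i) ∙ x ⊕ c i ⊗ U j ∙ x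
  eliminate-∙ U j c cancels x i = begin
    eliminate U j c i ∙ x′
      ≡⟨ ∙-+ˡ (tails U k) (λ l → c i ⊗ tails U j l) x′ ⟩
    tails U k ∙ x′ ⊕ (λ l → c i ⊗ tails U j l) ∙ x′
      ≡⟨ cong (tails U k ∙ x′ ⊕_) (∙-*ˡ (c i) (tails U j) x′) ⟩
    tails U k ∙ x′ ⊕ c i ⊗ tails U j ∙ x′
      ≡⟨ ⊕-identityˡ (tails U k ∙ x′ ⊕ c i ⊗ tails U j ∙ x′) ⟨
    0F ⊕ (tails U k ∙ x′ ⊕ c i ⊗ tails U j ∙ x′)
      ≡⟨ cong (_⊕ (tails U k ∙ x′ ⊕ c i ⊗ tails U j ∙ x′)) (trans (cong (_⊗ x fz) (cancels i)) (⊗-zeroˡ (x fz))) ⟨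
    (U k fz ⊕ c i ⊗ U j fz) ⊗ x fz ⊕ (tails U k ∙ x′ ⊕ c i ⊗ tails U j ∙ x′)
      ≡⟨ solve 6 (λ a c b x s t → (a :+ c :* b) :* x :+ (s :+ c :* t) := (a :* x :+ s) :+ c :* (b :* x :+ t))
           refl (U k fz) (c i) (U j fz) (x fz) (tails U k ∙ x′) (tails U j ∙ x′) ⟩
    U k ∙ x ⊕ c i ⊗ U j ∙ x ∎
    where
    open ≡-Reasoning
    k = punchIn j i
    x′ = x ∘ fs

  -- A dependency `y` of the reduced rows becomes one of the rows of `U` once row `j` receives the
  -- coefficient `y ∙ c`, the total multiple of it that was mixed in; the first column is covered by
  -- `Cancels`.
  eliminate-LinIndep : {r n : ℕ} (U : Mat {p} (suc r) (suc n)) (j : Fin (suc r)) (c : Fin r → Fin p) → Cancels U j c →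
    LinIndep U → LinIndep (eliminate U j c)
  eliminate-LinIndep {r} {n} U j c cancels indep y y·U′≡0 i =
    trans (sym (insertAt-punchIn y j (y ∙ c) i)) (indep y⁺ y⁺·U≡0 (punchIn j i))
    where
    open ≡-Reasoning
    y⁺ = insertAt y j (y ∙ c)
    y⁺·U : ∀ l → (y⁺ ·ᵥ U) l ≡ y ∙ (λ i → U (punchIn j i) l ⊕ c i ⊗ U j l)
    y⁺·U l = begin
      (y⁺ ·ᵥ U) l
        ≡⟨ ΣF-punchIn j (λ i → y⁺ i ⊗ U i l) ⟩
      y⁺ j ⊗ U j l ⊕ ΣF r (λ i → y⁺ (punchIn j i) ⊗ U (punchIn j i) l)
        ≡⟨ cong₂ _⊕_ (cong (_⊗ U j l) (insertAt-lookup y j (y ∙ c)))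
             (ΣF-cong (λ i → cong (_⊗ U (punchIn j i) l) (insertAt-punchIn y j (y ∙ c) i))) ⟩
      y ∙ c ⊗ U j l ⊕ y ∙ (λ i → U (punchIn j i) l)
        ≡⟨ cong (_⊕ y ∙ (λ i → U (punchIn j i) l)) (trans (⊗-comm (y ∙ c) (U j l)) (sym (ΣF-*ˡ (U j l) (λ i → y i ⊗ c i)))) ⟩
      ΣF r (λ i → U j l ⊗ (y i ⊗ c i)) ⊕ y ∙ (λ i → U (punchIn j i) l)
        ≡⟨ ΣF-+ (λ i → U j l ⊗ (y i ⊗ c i)) (λ i → y i ⊗ U (punchIn j i) l) ⟨
      ΣF r (λ i → U j l ⊗ (y i ⊗ c i) ⊕ y i ⊗ U (punchIn j i) l)
        ≡⟨ ΣF-cong (λ i → solve 4 (λ u y c v → u :* (y :* c) :+ y :* v := y :* (v :+ c :* u)) refl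
             (U j l) (y i) (c i) (U (punchIn j i) l)) ⟩
      y ∙ (λ i → U (punchIn j i) l ⊕ c i ⊗ U j l) ∎
    y⁺·U≡0 : ∀ l → (y⁺ ·ᵥ U) l ≡ 0F
    y⁺·U≡0 fz     = trans (y⁺·U fz) (ΣF-zero (λ i → trans (cong (y i ⊗_) (cancels i)) (⊗-zeroʳ (y i))))
    y⁺·U≡0 (fs l) = trans (y⁺·U (fs l)) (y·U′≡0 l)

  tails-LinIndep : {r n : ℕ} (U : Mat {p} r (suc n)) → (∀ i → U i fz ≡ 0F) → LinIndep U → LinIndep (tails U)
  tails-LinIndep U U₀≡0 indep y y·U′≡0 = indep y λ where
    fz     → ΣF-zero (λ i → trans (cong (y i ⊗_) (U₀≡0 i)) (⊗-zeroʳ (y i)))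
    (fs l) → y·U′≡0 l

  module _ (pr : Prime p) where

    cancelling : {r n : ℕ} (U : Mat {p} (suc r) (suc n)) (j : Fin (suc r)) → ¬ (U j fz ≡ 0F) → ∃ (Cancels U j)
    cancelling U j Uj≢0 = (λ i → (⊖ U (punchIn j i) fz) ⊗ inv) , λ i → begin
      U (punchIn j i) fz ⊕ ((⊖ U (punchIn j i) fz) ⊗ inv) ⊗ U j fz
        ≡⟨ cong (U (punchIn j i) fz ⊕_) (solve 3 (λ a b c → (a :* b) :* c := a :* (c :* b)) refl
             (⊖ U (punchIn j i) fz) inv (U j fz)) ⟩
      U (punchIn j i) fz ⊕ (⊖ U (punchIn j i) fz) ⊗ (U j fz ⊗ inv)
        ≡⟨ cong (λ t → U (punchIn j i) fz ⊕ (⊖ U (punchIn j i) fz) ⊗ t) (proj₂ invertible) ⟩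
      U (punchIn j i) fz ⊕ (⊖ U (punchIn j i) fz) ⊗ 1F
        ≡⟨ cong (U (punchIn j i) fz ⊕_) (⊗-identityʳ (⊖ U (punchIn j i) fz)) ⟩
      U (punchIn j i) fz ⊕ (⊖ U (punchIn j i) fz)
        ≡⟨ ⊕-inverseʳ (U (punchIn j i) fz) ⟩
      0F ∎
      where
      open ≡-Reasoning
      invertible = ≢0F⇒invertible pr (U j fz) Uj≢0
      inv = proj₁ invertible

    LinIndep-[]⇒empty : {r : ℕ} {U : Mat {p} r 0} → LinIndep U → r ≡ 0
    LinIndep-[]⇒empty {zero}  indep = refl
    LinIndep-[]⇒empty {suc r} indep = contradiction (indep (λ _ → 1F) (λ ()) fz) (1F≢0F pr)

    -- The case split of the elimination. Indexing by `r` lets a match on `pivot` reveal that the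
    -- number of rows is a successor, as `eliminate` requires.
    data ColumnView {n : ℕ} : {r : ℕ} → Mat {p} r (suc n) → Set where
      zeroColumn : {r : ℕ} {U : Mat {p} r (suc n)} → (∀ i → U i fz ≡ 0F) → ColumnView U
      pivot : {r : ℕ} {U : Mat {p} (suc r) (suc n)} (j : Fin (suc r)) → ¬ (U j fz ≡ 0F) → ColumnView U

    columnView : {r n : ℕ} (U : Mat {p} r (suc n)) → ColumnView U
    columnView {zero} U = zeroColumn λ ()
    columnView {suc r} U with any? (λ i → ¬? (U i fz ≟ 0F))
    ... | yes (j , Uj≢0) = pivot j Uj≢0
    ... | no none = zeroColumn λ i → decidable-stable (U i fz ≟ 0F) (λ Ui≢0 → none (i , Ui≢0))

    -- Back substitution: the pivot equation fixes the first variable, and the other equations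
    -- follow from the reduced ones by subtracting the added multiple of the pivot equation.
    eliminate-solvable : {r n : ℕ} (U : Mat {p} (suc r) (suc n)) (j : Fin (suc r)) (e : Fin r → Fin p) → Cancels U j e →
      (v : Fin p) → U j fz ⊗ v ≡ 1F → (c : Vecₚ {p} (suc r)) (x : Vecₚ {p} n) →
      (∀ i → eliminate U j e i ∙ x ≡ c (punchIn j i) ⊕ e i ⊗ c j) → ∃ λ x⁺ → ∀ i → U i ∙ x⁺ ≡ c i
    eliminate-solvable {r} {n} U j e cancels v Uj⊗v≡1 c x U′x≡c′ = x⁺ , Ux⁺≡c
      where
      open ≡-Reasoning
      x₀ = (c j ⊖ tails U j ∙ x) ⊗ v
      x⁺ : Vecₚ {p} (suc n)
      x⁺ = insertAt x fz x₀
      Ujx⁺≡cj : U j ∙ x⁺ ≡ c j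
      Ujx⁺≡cj = begin
        U j fz ⊗ x₀ ⊕ tails U j ∙ x
          ≡⟨ cong (_⊕ tails U j ∙ x) (solve 3 (λ u d v → u :* (d :* v) := (u :* v) :* d) refl
             (U j fz) (c j ⊖ tails U j ∙ x) v) ⟩
        (U j fz ⊗ v) ⊗ (c j ⊖ tails U j ∙ x) ⊕ tails U j ∙ x
          ≡⟨ cong (λ t → t ⊗ (c j ⊖ tails U j ∙ x) ⊕ tails U j ∙ x) Uj⊗v≡1 ⟩
        1F ⊗ (c j ⊖ tails U j ∙ x) ⊕ tails U j ∙ x
          ≡⟨ cong (_⊕ tails U j ∙ x) (⊗-identityˡ (c j ⊖ tails U j ∙ x)) ⟩
        (c j ⊖ tails U j ∙ x) ⊕ tails U j ∙ x
          ≡⟨ ⊖-⊕-cancel (c j) (tails U j ∙ x) ⟩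
        c j ∎
      Ux⁺≡c-punchIn : ∀ i → U (punchIn j i) ∙ x⁺ ≡ c (punchIn j i)
      Ux⁺≡c-punchIn i = ⊕-cancelˡ (e i ⊗ c j) (begin
        e i ⊗ c j ⊕ U (punchIn j i) ∙ x⁺          ≡⟨ ⊕-comm (e i ⊗ c j) (U (punchIn j i) ∙ x⁺) ⟩
        U (punchIn j i) ∙ x⁺ ⊕ e i ⊗ c j          ≡⟨ cong (λ t → U (punchIn j i) ∙ x⁺ ⊕ e i ⊗ t) Ujx⁺≡cj ⟨
        U (punchIn j i) ∙ x⁺ ⊕ e i ⊗ U j ∙ x⁺     ≡⟨ eliminate-∙ U j e cancels x⁺ i ⟨
        eliminate U j e i ∙ x                       ≡⟨ U′x≡c′ i ⟩
        c (punchIn j i) ⊕ e i ⊗ c j               ≡⟨ ⊕-comm (c (punchIn j i)) (e i ⊗ c j) ⟩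
        e i ⊗ c j ⊕ c (punchIn j i)               ∎)
      Ux⁺≡c : ∀ i → U i ∙ x⁺ ≡ c i
      Ux⁺≡c i with j ≟ i
      ... | yes refl = Ujx⁺≡cj
      ... | no j≢i = subst (λ i → U i ∙ x⁺ ≡ c i) (punchIn-punchOut j≢i) (Ux⁺≡c-punchIn (punchOut j≢i))

    -- Independent rows define a surjective linear map. Induction on the columns: the variable of a
    -- zero column is set to 0, and that of a pivot column is found by back substitution.
    LinIndep⇒solvable : {r n : ℕ} (U : Mat {p} r n) → LinIndep U → (c : Vecₚ {p} r) → ∃ λ x → ∀ i → U i ∙ x ≡ c i
    LinIndep⇒solvable {n = zero} U indep c with refl ← LinIndep-[]⇒empty {U = U} indep = (λ ()) , λ ()
    LinIndep⇒solvable {n = suc n} U indep c with columnView U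
    ... | zeroColumn U₀≡0 =
      let x , Ux≡c = LinIndep⇒solvable (tails U) (tails-LinIndep U U₀≡0 indep) c
      in insertAt x fz 0F , λ i →
           trans (cong (_⊕ tails U i ∙ x) (⊗-zeroʳ (U i fz))) (trans (⊕-identityˡ (tails U i ∙ x)) (Ux≡c i))
    ... | pivot j Uj≢0 =
      let e , cancels = cancelling U j Uj≢0
          v , Uj⊗v≡1  = ≢0F⇒invertible pr (U j fz) Uj≢0
          x , U′x≡c′  = LinIndep⇒solvable (eliminate U j e) (eliminate-LinIndep U j e cancels indep)
                          (λ i → c (punchIn j i) ⊕ e i ⊗ c j)
      in eliminate-solvable U j e cancels v Uj⊗v≡1 c x U′x≡c′

-- Counting 0-1 assignments

-- Branching on the first bit matches the column-by-column induction of `count-solutions`.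
count : {n : ℕ} → (Vec Bool n → Bool) → ℕ
count {zero}  P = if P [] then 1 else 0
count {suc n} P = count (P ∘ (false ∷_)) + count (P ∘ (true ∷_))

count≡0⊎∃ : {n : ℕ} (P : Vec Bool n → Bool) → count P ≡ 0 ⊎ ∃ λ α → T (P α)
count≡0⊎∃ {zero} P with P [] in eq
... | false = inj₁ refl
... | true  = inj₂ ([] , subst T (sym eq) tt)
count≡0⊎∃ {suc n} P with count≡0⊎∃ (P ∘ (false ∷_)) | count≡0⊎∃ (P ∘ (true ∷_))
... | inj₂ (α , Pα) | _             = inj₂ (false ∷ α , Pα)
... | inj₁ _        | inj₂ (α , Pα) = inj₂ (true ∷ α , Pα)
... | inj₁ eq₀      | inj₁ eq₁      = inj₁ (cong₂ _+_ eq₀ eq₁)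

count-disjoint : {n : ℕ} (P Q : Vec Bool n → Bool) → (∀ α → T (P α) → ¬ T (Q α)) →
  count P + count Q ≤ count (λ α → P α ∨ Q α)
count-disjoint {zero} P Q disjoint with P [] | Q [] | disjoint []
... | false | _     | _ = ℕ.≤-refl
... | true  | false | _ = ℕ.≤-refl
... | true  | true  | d = contradiction tt (d tt)
count-disjoint {suc n} P Q disjoint = begin
  (count P₀ + count P₁) + (count Q₀ + count Q₁)
    ≡⟨ interchange (count P₀) (count P₁) (count Q₀) (count Q₁) ⟩
  (count P₀ + count Q₀) + (count P₁ + count Q₁)
    ≤⟨ ℕ.+-mono-≤ (count-disjoint P₀ Q₀ (disjoint ∘ (false ∷_))) (count-disjoint P₁ Q₁ (disjoint ∘ (true ∷_))) ⟩
  count (λ α → P α ∨ Q α) ∎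
  where
  open ℕ.≤-Reasoning
  open import Algebra.Properties.CommutativeSemigroup ℕ.+-commutativeSemigroup using (interchange)
  P₀ = P ∘ (false ∷_)
  P₁ = P ∘ (true ∷_)
  Q₀ = Q ∘ (false ∷_)
  Q₁ = Q ∘ (true ∷_)

≤sum : {N : ℕ} (t : Fin N → ℕ) (v : Fin N) → t v ≤ sum t
≤sum t fz     = ℕ.m≤m+n (t fz) _
≤sum t (fs v) = ℕ.≤-trans (≤sum (t ∘ fs) v) (ℕ.m≤n+m _ (t fz))

*-sum-≤ : {N : ℕ} (M B : ℕ) (t : Fin N → ℕ) → (∀ v → M * t v ≤ B) → M * sum t ≤ N * B
*-sum-≤ {zero}  M B t bound = ℕ.≤-reflexive (ℕ.*-zeroʳ M)
*-sum-≤ {suc N} M B t bound = begin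
  M * (t fz + sum (t ∘ fs))       ≡⟨ ℕ.*-distribˡ-+ M (t fz) _ ⟩
  M * t fz + M * sum (t ∘ fs)     ≤⟨ ℕ.+-mono-≤ (bound fz) (*-sum-≤ M B (t ∘ fs) (bound ∘ fs)) ⟩
  B + N * B                       ∎
  where open ℕ.≤-Reasoning

-- Each assignment is counted in the fibre over its own image. Induction on `n`: fixing the first
-- bit splits every fibre into two.
2^≤sum-fibres : {n N : ℕ} (f : Vec Bool n → Fin N) → 2 ^ n ≤ sum (λ v → count (λ α → ⌊ f α ≟ v ⌋))
2^≤sum-fibres {zero} f = ℕ.≤-trans hit (≤sum (λ v → count (λ α → ⌊ f α ≟ v ⌋)) (f []))
  where
  hit : 1 ≤ (if ⌊ f [] ≟ f [] ⌋ then 1 else 0)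
  hit with f [] ≟ f []
  ... | yes _ = ℕ.≤-refl
  ... | no ≢  = contradiction refl ≢
2^≤sum-fibres {suc n} {N} f = begin
  2 ^ n + (2 ^ n + 0)      ≡⟨ cong (2 ^ n +_) (ℕ.+-identityʳ (2 ^ n)) ⟩
  2 ^ n + 2 ^ n            ≤⟨ ℕ.+-mono-≤ (2^≤sum-fibres (f ∘ (false ∷_))) (2^≤sum-fibres (f ∘ (true ∷_))) ⟩
  sum (fibre false) + sum (fibre true)               ≡⟨ ∑-distrib-+ (fibre false) (fibre true) ⟨
  sum (λ v → count (λ α → ⌊ f α ≟ v ⌋))              ∎
  where
  open ℕ.≤-Reasoning
  fibre : Bool → Fin N → ℕ
  fibre b v = count (λ α → ⌊ f (b ∷ α) ≟ v ⌋)

-- Pigeonhole: summing the bounds over the `N` fibres gives `M * 2 ^ n ≤ N * 2 ^ n`, and the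
-- positive factor `2 ^ n` cancels.
fibres-bound : {n N : ℕ} (f : Vec Bool n → Fin N) (M : ℕ) →
  (∀ v → M * count (λ α → ⌊ f α ≟ v ⌋) ≤ 2 ^ n) → M ≤ N
fibres-bound {n} {N} f M bound = ℕ.*-cancelʳ-≤ M N (2 ^ n) {{ℕ.m^n≢0 2 n}}
  (ℕ.≤-trans (ℕ.*-monoʳ-≤ M (2^≤sum-fibres f)) (*-sum-≤ M (2 ^ n) (λ v → count (λ α → ⌊ f α ≟ v ⌋)) bound))

module _ {p : ℕ} .{{_ : NonZero p}} where

  bits : {n : ℕ} → Vec Bool n → Vecₚ {p} n
  bits α i = bit (Vec.lookup α i)

  module _ (pr : Prime p) where

    -- Each independent equation halves the number of 0-1 points. If the first column is zero, both
    -- values of the first bit leave the same system, so the two counts and the bound double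
    -- together. At a pivot the two halves are disjoint as sets of tails, so they merge into one
    -- solution set of the reduced system, which has one row fewer; this yields the factor 2.
    count-solutions : {r n : ℕ} (U : Mat {p} r n) → LinIndep U → (c : Vecₚ {p} r) (P : Vec Bool n → Bool) →
      (∀ α → T (P α) → ∀ i → U i ∙ bits α ≡ c i) → 2 ^ r * count P ≤ 2 ^ n
    count-solutions {n = zero} U indep c P sol with refl ← LinIndep-[]⇒empty pr {U = U} indep with P []
    ... | true  = ℕ.≤-refl
    ... | false = z≤n
    count-solutions {r} {suc n} U indep c P sol with columnView pr U
    ... | zeroColumn U₀≡0 = begin
        2 ^ r * (count (P ∘ (false ∷_)) + count (P ∘ (true ∷_)))
          ≡⟨ ℕ.*-distribˡ-+ (2 ^ r) (count (P ∘ (false ∷_))) _ ⟩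
        2 ^ r * count (P ∘ (false ∷_)) + 2 ^ r * count (P ∘ (true ∷_))
          ≤⟨ ℕ.+-mono-≤ (half false) (half true) ⟩
        2 ^ n + 2 ^ n
          ≡⟨ cong (2 ^ n +_) (ℕ.+-identityʳ (2 ^ n)) ⟨
        2 ^ suc n ∎
      where
      open ℕ.≤-Reasoning
      half : ∀ b → 2 ^ r * count (P ∘ (b ∷_)) ≤ 2 ^ n
      half b = count-solutions (tails U) (tails-LinIndep U U₀≡0 indep) c (P ∘ (b ∷_)) λ α Pα i →
        trans (sym (⊕-identityˡ (tails U i ∙ bits α)))
          (trans (cong (_⊕ tails U i ∙ bits α) (sym (trans (cong (_⊗ bit b) (U₀≡0 i)) (⊗-zeroˡ (bit b)))))
            (sol (b ∷ α) Pα i))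
    ... | pivot {r} j Uj≢0 = begin
        2 ^ suc r * (count P₀ + count P₁)
          ≤⟨ ℕ.*-monoʳ-≤ (2 ^ suc r) (count-disjoint P₀ P₁ disjoint) ⟩
        2 * 2 ^ r * count (λ α → P₀ α ∨ P₁ α)
          ≡⟨ ℕ.*-assoc 2 (2 ^ r) _ ⟩
        2 * (2 ^ r * count (λ α → P₀ α ∨ P₁ α))
          ≤⟨ ℕ.*-monoʳ-≤ 2 (count-solutions (eliminate U j e) (eliminate-LinIndep U j e cancels indep)
               (λ i → c (punchIn j i) ⊕ e i ⊗ c j) (λ α → P₀ α ∨ P₁ α) sol′) ⟩
        2 ^ suc n ∎
      where
      open ℕ.≤-Reasoning
      P₀ = P ∘ (false ∷_)
      P₁ = P ∘ (true ∷_)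
      e = proj₁ (cancelling pr U j Uj≢0)
      cancels = proj₂ (cancelling pr U j Uj≢0)
      -- The pivot equation determines the first bit from the others.
      disjoint : ∀ α → T (P₀ α) → ¬ T (P₁ α)
      disjoint α P₀α P₁α = Uj≢0 (⊕-cancelˡ (tails U j ∙ bits α)
          (trans (⊕-comm (tails U j ∙ bits α) (U j fz))
          (trans (cong (_⊕ tails U j ∙ bits α) (sym (⊗-identityʳ (U j fz))))
          (trans (sol (true ∷ α) P₁α j)
          (trans (sym (sol (false ∷ α) P₀α j))
          (trans (cong (_⊕ tails U j ∙ bits α) (⊗-zeroʳ (U j fz)))
          (⊕-comm 0F (tails U j ∙ bits α))))))))
      sol-eliminate : ∀ b α → T (P (b ∷ α)) → ∀ i → eliminate U j e i ∙ bits α ≡ c (punchIn j i) ⊕ e i ⊗ c j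
      sol-eliminate b α Pα i = trans (eliminate-∙ U j e cancels (bits (b ∷ α)) i)
        (cong₂ (λ s t → s ⊕ e i ⊗ t) (sol (b ∷ α) Pα (punchIn j i)) (sol (b ∷ α) Pα j))
      sol′ : ∀ α → T (P₀ α ∨ P₁ α) → ∀ i → eliminate U j e i ∙ bits α ≡ c (punchIn j i) ⊕ e i ⊗ c j
      sol′ α with P₀ α in P₀α | P₁ α in P₁α
      ... | true  | _    = λ _ → sol-eliminate false α (subst T (sym P₀α) tt)
      ... | false | true = λ _ → sol-eliminate true α (subst T (sym P₁α) tt)

-- Restrictions and their lifts to the span of the system

assign : {n : ℕ} → Subset n → Vec Bool n → Fin n → Maybe Bool
assign S α i = if Vec.lookup S i then just (Vec.lookup α i) else nothing

∣p∪q∣≤∣p∣+∣q∣ : {n : ℕ} (S R : Subset n) → ∣ S ∪ R ∣ ≤ ∣ S ∣ + ∣ R ∣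
∣p∪q∣≤∣p∣+∣q∣ []          []          = z≤n
∣p∪q∣≤∣p∣+∣q∣ (false ∷ S) (false ∷ R) = ∣p∪q∣≤∣p∣+∣q∣ S R
∣p∪q∣≤∣p∣+∣q∣ (false ∷ S) (true ∷ R)  = ℕ.≤-trans (s≤s (∣p∪q∣≤∣p∣+∣q∣ S R)) (ℕ.≤-reflexive (sym (ℕ.+-suc ∣ S ∣ ∣ R ∣)))
∣p∪q∣≤∣p∣+∣q∣ (true ∷ S)  (false ∷ R) = s≤s (∣p∪q∣≤∣p∣+∣q∣ S R)
∣p∪q∣≤∣p∣+∣q∣ (true ∷ S)  (true ∷ R)  = s≤s (ℕ.≤-trans (∣p∪q∣≤∣p∣+∣q∣ S R) (ℕ.+-monoʳ-≤ ∣ S ∣ (ℕ.n≤1+n ∣ R ∣)))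

module _ {p : ℕ} .{{_ : NonZero p}} where

  drop keep : {n : ℕ} → Subset n → Vecₚ {p} n → Vecₚ {p} n
  drop S u i = if Vec.lookup S i then 0F else u i
  keep S u i = if Vec.lookup S i then u i else 0F

  -- Stated pointwise so that it covers both `assign S α` and the one-variable assignments
  -- `single x a` on the edges of the dag.
  Assigns : {n : ℕ} → PAssign {p} n → Subset n → Vec Bool n → Set
  Assigns ρ S α = ∀ i → ρ i ≡ assign S α i

  suppSize-Assigns : {n : ℕ} {ρ : PAssign {p} n} (S : Subset n) (α : Vec Bool n) → Assigns ρ S α → suppSize {p} ρ ≡ ∣ S ∣
  suppSize-Assigns [] [] ρ≡ = refl
  suppSize-Assigns {ρ = ρ} (s ∷ S) (a ∷ α) ρ≡ with ρ fz | s | ρ≡ fz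
  ... | just _  | true  | _ = cong suc (suppSize-Assigns S α (ρ≡ ∘ fs))
  ... | nothing | false | _ = suppSize-Assigns S α (ρ≡ ∘ fs)

  ω≤∣∣ : {n : ℕ} (u : Vecₚ {p} n) (S : Subset n) → (∀ i → drop S u i ≡ 0F) → ω u ≤ ∣ S ∣
  ω≤∣∣ u [] _ = z≤n
  ω≤∣∣ u (s ∷ S) zero-off with u fz ≟ 0F | s | zero-off fz
  ... | yes _  | false | _ = ω≤∣∣ (u ∘ fs) S (zero-off ∘ fs)
  ... | yes _  | true  | _ = ℕ.m≤n⇒m≤1+n (ω≤∣∣ (u ∘ fs) S (zero-off ∘ fs))
  ... | no u≢0 | false | z = contradiction z u≢0
  ... | no _   | true  | _ = s≤s (ω≤∣∣ (u ∘ fs) S (zero-off ∘ fs))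

  keep+drop : {n : ℕ} (S : Subset n) (u : Vecₚ {p} n) (i : Fin n) → u i ≡ keep S u i ⊕ drop S u i
  keep+drop S u i with Vec.lookup S i
  ... | true  = sym (⊕-identityʳ (u i))
  ... | false = sym (⊕-identityˡ (u i))

  colRestrict-keep : {n : ℕ} {ρ : PAssign {p} n} {S : Subset n} {α : Vec Bool n} → Assigns ρ S α →
    (u : Vecₚ {p} n) (i : Fin n) → colRestrict ρ u i ≡ keep S u i
  colRestrict-keep {ρ = ρ} {S} ρ≡ u i with ρ i | Vec.lookup S i | ρ≡ i
  ... | just _  | true  | _ = refl
  ... | nothing | false | _ = refl

  restrict-coef : {n : ℕ} {ρ : PAssign {p} n} {S : Subset n} {α : Vec Bool n} → Assigns ρ S α →
    (e : Eqn {p} n) (i : Fin n) → coef (restrict ρ e) i ≡ drop S (coef e) i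
  restrict-coef {ρ = ρ} {S} ρ≡ e i with ρ i | Vec.lookup S i | ρ≡ i
  ... | just _  | true  | _ = refl
  ... | nothing | false | _ = refl

  -- The summand is a local function of restrict, reachable only by unification.
  restrict-summand : {n : ℕ} (ρ : PAssign {p} n) (e : Eqn {p} n) →
    Σ (Fin n → Fin p) λ f → const (restrict ρ e) ≡ const e ⊖ ΣF n f
  restrict-summand ρ e = _ , refl

  restrict-const : {n : ℕ} {ρ : PAssign {p} n} {S : Subset n} {α : Vec Bool n} → Assigns ρ S α →
    (e : Eqn {p} n) → const (restrict ρ e) ≡ const e ⊖ keep S (coef e) ∙ bits α
  restrict-const {ρ = ρ} {S} {α} ρ≡ e = cong (λ t → const e ⊖ t) (ΣF-cong summand)
    where
    summand : ∀ i → proj₁ (restrict-summand ρ e) i ≡ keep S (coef e) i ⊗ bits α i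
    summand i with ρ i | Vec.lookup S i | ρ≡ i
    ... | just b  | true  | refl = refl
    ... | nothing | false | _    = sym (⊗-zeroˡ (bits α i))

  drop-∪ : {n : ℕ} (S R : Subset n) (u : Vecₚ {p} n) (i : Fin n) → drop (S ∪ R) u i ≡ drop R (drop S u) i
  drop-∪ S R u i rewrite lookup-zipWith _∨_ i S R with Vec.lookup S i | Vec.lookup R i
  ... | true  | true  = refl
  ... | true  | false = refl
  ... | false | true  = refl
  ... | false | false = refl

  keep-∪ : {n : ℕ} (S R : Subset n) (u : Vecₚ {p} n) (i : Fin n) →
    keep (S ∪ R) u i ≡ keep S u i ⊕ keep R (drop S u) i
  keep-∪ S R u i rewrite lookup-zipWith _∨_ i S R with Vec.lookup S i | Vec.lookup R i
  ... | true  | true  = sym (⊕-identityʳ (u i))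
  ... | true  | false = sym (⊕-identityʳ (u i))
  ... | false | true  = sym (⊕-identityˡ (u i))
  ... | false | false = sym (⊕-identityˡ 0F)

  -- Variables outside `R` do not occur in `u`, so it does not matter whether they are assigned.
  -- This and `keep-∩` allow the walk to forget variables.
  drop-∩ : {n : ℕ} (S R : Subset n) (u : Vecₚ {p} n) → (∀ i → drop R u i ≡ 0F) → (i : Fin n) →
    drop (S ∩ R) u i ≡ drop S u i
  drop-∩ S R u zero-off i rewrite lookup-zipWith _∧_ i S R with Vec.lookup S i | Vec.lookup R i | zero-off i
  ... | true  | true  | _ = refl
  ... | true  | false | z = z
  ... | false | _     | _ = refl

  keep-∩ : {n : ℕ} (S R : Subset n) (u : Vecₚ {p} n) → (∀ i → drop R u i ≡ 0F) → (i : Fin n) →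
    keep (S ∩ R) u i ≡ keep S u i
  keep-∩ S R u zero-off i rewrite lookup-zipWith _∧_ i S R with Vec.lookup S i | Vec.lookup R i | zero-off i
  ... | true  | true  | _ = refl
  ... | true  | false | z = sym z
  ... | false | _     | _ = refl

  drop-·ᵥ : {k n : ℕ} (S : Subset n) (y : Vecₚ {p} k) (M : Mat {p} k n) (i : Fin n) →
    drop S (y ·ᵥ M) i ≡ (y ·ᵥ (drop S ∘ M)) i
  drop-·ᵥ S y M i with Vec.lookup S i
  ... | true  = sym (ΣF-zero (λ j → ⊗-zeroʳ (y j)))
  ... | false = refl

  keep-·ᵥ : {k n : ℕ} (S : Subset n) (y : Vecₚ {p} k) (M : Mat {p} k n) (i : Fin n) →
    keep S (y ·ᵥ M) i ≡ (y ·ᵥ (keep S ∘ M)) i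
  keep-·ᵥ S y M i with Vec.lookup S i
  ... | true  = refl
  ... | false = sym (ΣF-zero (λ j → ⊗-zeroʳ (y j)))

  drop-cong : {n : ℕ} (S : Subset n) {u v : Vecₚ {p} n} → (∀ i → u i ≡ v i) → ∀ i → drop S u i ≡ drop S v i
  drop-cong S eq i with Vec.lookup S i
  ... | true  = refl
  ... | false = eq i

  keep-cong : {n : ℕ} (S : Subset n) {u v : Vecₚ {p} n} → (∀ i → u i ≡ v i) → ∀ i → keep S u i ≡ keep S v i
  keep-cong S eq i with Vec.lookup S i
  ... | true  = eq i
  ... | false = refl

  drop-⊥ : {n : ℕ} (u : Vecₚ {p} n) (i : Fin n) → drop ⊥ u i ≡ u i
  drop-⊥ u i rewrite lookup-replicate i false = refl

  keep-⊥ : {n : ℕ} (u : Vecₚ {p} n) (i : Fin n) → keep ⊥ u i ≡ 0F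
  keep-⊥ u i rewrite lookup-replicate i false = refl

  single-Assigns : {n : ℕ} (x : Fin n) (α : Vec Bool n) → Assigns (single x (Vec.lookup α x)) ⁅ x ⁆ α
  single-Assigns x α i with x ≟ i | Vec.lookup ⁅ x ⁆ i in eq
  ... | yes refl | true  = refl
  ... | yes refl | false = contradiction (trans (sym eq) ([]=⇒lookup (x∈⁅x⁆ x))) λ ()
  ... | no x≢i   | true  = contradiction (sym (x∈⁅y⁆⇒x≡y x (lookup⇒[]= i ⁅ x ⁆ eq))) x≢i
  ... | no _     | false = refl

  unit : {n : ℕ} → Fin n → Vecₚ {p} n
  unit i l = if ⌊ i ≟ l ⌋ then 1F else 0F

  unit-∙ : {n : ℕ} (i : Fin n) (x : Vecₚ {p} n) → unit i ∙ x ≡ x i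
  unit-∙ fz x = trans (cong₂ _⊕_ (⊗-identityˡ (x fz)) (ΣF-zero (λ l → ⊗-zeroˡ (x (fs l))))) (⊕-identityʳ (x fz))
  unit-∙ (fs i) x = trans (cong₂ _⊕_ (⊗-zeroˡ (x fz)) (trans (∙-congˡ (x ∘ fs) unit-fs) (unit-∙ i (x ∘ fs))))
      (⊕-identityˡ (x (fs i)))
    where
    unit-fs : ∀ l → unit (fs i) (fs l) ≡ unit i l
    unit-fs l with i ≟ l
    ... | yes _ = refl
    ... | no _  = refl

  lookup-∈⟨⟩ : {n : ℕ} (L : System {p} n) (j : Fin (length L)) → lookup L j ∈⟨ L ⟩
  lookup-∈⟨⟩ L j = unit j , (λ i → unit-∙ j (λ l → coef (lookup L l) i)) , unit-∙ j (λ l → const (lookup L l))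

  -- The positions of `tabulate f` form `Fin (length (tabulate f))` rather than `Fin k`, so
  -- coefficients must be reindexed. Quantifying over `h` after `z` makes one vector serve every
  -- coefficient and the constant of the equations.
  tabulate-coefficients : {X : Set} {k : ℕ} (f : Fin k → X) (y : Vecₚ {p} k) →
    Σ (Fin (length (tabulate f)) → Fin p) λ z → (h : X → Fin p) → z ∙ (h ∘ lookup (tabulate f)) ≡ y ∙ (h ∘ f)
  tabulate-coefficients {k = zero}  f y = (λ ()) , λ h → refl
  tabulate-coefficients {k = suc k} f y =
    let z , z≡ = tabulate-coefficients (f ∘ fs) (y ∘ fs)
    in (λ { fz → y fz ; (fs l) → z l }) , λ h → cong (y fz ⊗ h (f fz) ⊕_) (z≡ h)

  module _ {k n : ℕ} (A : Mat {p} k n) (b : Vecₚ {p} k) where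

    comb : Vecₚ {p} k → Eqn {p} n
    comb y = eqn (y ·ᵥ A) (y ∙ b)

    comb-∈⟨⟩ : (y : Vecₚ {p} k) → comb y ∈⟨ sysOf A b ⟩
    comb-∈⟨⟩ y =
      let z , z≡ = tabulate-coefficients (λ i → eqn (A i) (b i)) y
      in z , (λ i → z≡ (λ e → coef e i)) , z≡ const

    -- e is the restriction of comb y by α on S; the constants are compared without subtraction.
    record Lifts (α : Vec Bool n) (S : Subset n) (y : Vecₚ {p} k) (e : Eqn {p} n) : Set where
      constructor mkLifts
      field
        coefs  : ∀ i → coef e i ≡ drop S (y ·ᵥ A) i
        consts : const e ⊕ keep S (y ·ᵥ A) ∙ bits α ≡ y ∙ b

    open Lifts

    restrict-comb : {α : Vec Bool n} {S : Subset n} {y : Vecₚ {p} k} {e : Eqn {p} n} →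
      Lifts α S y e → restrict (assign S α) (comb y) ≈E e
    restrict-comb {α} {S} {y} {e} l =
      (λ i → trans (restrict-coef {S = S} {α} (λ _ → refl) (comb y) i) (sym (coefs l i))) ,
      trans (restrict-const {S = S} {α} (λ _ → refl) (comb y)) (sym (≡⊕⇒≡⊖ (sym (consts l))))

    -- Restriction by a fixed assignment is linear, so a combination of equations lifts to the same
    -- combination of their lifts.
    lift-lincomb : {α : Vec Bool n} {S : Subset n} (L : System {p} n) (Y : Mat {p} (length L) k) →
      (∀ j → Lifts α S (Y j) (lookup L j)) → (z : Vecₚ {p} (length L)) → Lifts α S (z ·ᵥ Y) (lincomb L z)
    lift-lincomb {α} {S} L Y lifts z = mkLifts
      (λ i → begin
        z ∙ (λ j → coef (lookup L j) i)        ≡⟨ ∙-congʳ z (λ j → coefs (lifts j) i) ⟩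
        (z ·ᵥ (drop S ∘ YA)) i                 ≡⟨ drop-·ᵥ S z YA i ⟨
        drop S (z ·ᵥ YA) i                     ≡⟨ drop-cong S assoc i ⟨
        drop S ((z ·ᵥ Y) ·ᵥ A) i               ∎)
      (begin
        z ∙ constants ⊕ keep S ((z ·ᵥ Y) ·ᵥ A) ∙ bits α
          ≡⟨ cong (z ∙ constants ⊕_) (∙-congˡ (bits α) (λ i → trans (keep-cong S assoc i) (keep-·ᵥ S z YA i))) ⟩
        z ∙ constants ⊕ (z ·ᵥ (keep S ∘ YA)) ∙ bits α
          ≡⟨ cong (z ∙ constants ⊕_) (·ᵥ-∙ z (keep S ∘ YA) (bits α)) ⟩
        z ∙ constants ⊕ z ∙ (λ j → keep S (YA j) ∙ bits α)
          ≡⟨ ∙-+ʳ z constants (λ j → keep S (YA j) ∙ bits α) ⟨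
        z ∙ (λ j → constants j ⊕ keep S (YA j) ∙ bits α)
          ≡⟨ ∙-congʳ z (λ j → consts (lifts j)) ⟩
        z ∙ (λ j → Y j ∙ b)
          ≡⟨ ·ᵥ-∙ z Y b ⟨
        (z ·ᵥ Y) ∙ b ∎)
      where
      open ≡-Reasoning
      YA : Mat {p} (length L) n
      YA j = Y j ·ᵥ A
      constants : Vecₚ {p} (length L)
      constants j = const (lookup L j)
      assoc : ∀ i → ((z ·ᵥ Y) ·ᵥ A) i ≡ (z ·ᵥ YA) i
      assoc i = ·ᵥ-∙ z Y (λ j → A j i)

    lift-≈E : {α : Vec Bool n} {S : Subset n} {y : Vecₚ {p} k} {e f : Eqn {p} n} → e ≈E f → Lifts α S y e → Lifts α S y f
    lift-≈E {α} {S} {y} (c≡ , d≡) l = mkLifts (λ i → trans (sym (c≡ i)) (coefs l i))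
      (trans (cong (_⊕ keep S (y ·ᵥ A) ∙ bits α) (sym d≡)) (consts l))

    -- The amount `t` that the new restriction subtracts from the constant is exactly what the
    -- `keep` term gains when `S` grows to `S ∪ R`.
    lift-restrict : {α : Vec Bool n} {S : Subset n} {y : Vecₚ {p} k} {e : Eqn {p} n} {ρ : PAssign {p} n} {R : Subset n} →
      Assigns ρ R α → Lifts α S y e → Lifts α (S ∪ R) y (restrict ρ e)
    lift-restrict {α} {S} {y} {e} {ρ} {R} ρ≡ l = mkLifts
      (λ i → begin
        coef (restrict ρ e) i            ≡⟨ restrict-coef {S = R} {α} ρ≡ e i ⟩
        drop R (coef e) i                ≡⟨ drop-cong R (coefs l) i ⟩
        drop R (drop S (y ·ᵥ A)) i       ≡⟨ drop-∪ S R (y ·ᵥ A) i ⟨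
        drop (S ∪ R) (y ·ᵥ A) i          ∎)
      (begin
        const (restrict ρ e) ⊕ keep (S ∪ R) (y ·ᵥ A) ∙ bits α
          ≡⟨ cong₂ _⊕_ (restrict-const {S = R} {α} ρ≡ e) split-keep ⟩
        (const e ⊖ t) ⊕ (s ⊕ t)
          ≡⟨ cong ((const e ⊖ t) ⊕_) (⊕-comm s t) ⟩
        (const e ⊖ t) ⊕ (t ⊕ s)
          ≡⟨ ⊕-assoc (const e ⊖ t) t s ⟨
        ((const e ⊖ t) ⊕ t) ⊕ s
          ≡⟨ cong (_⊕ s) (⊖-⊕-cancel (const e) t) ⟩
        const e ⊕ s
          ≡⟨ consts l ⟩
        y ∙ b ∎)
      where
      open ≡-Reasoning
      s = keep S (y ·ᵥ A) ∙ bits α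
      t = keep R (coef e) ∙ bits α
      split-keep : keep (S ∪ R) (y ·ᵥ A) ∙ bits α ≡ s ⊕ t
      split-keep = trans (∙-congˡ (bits α) (λ i → trans (keep-∪ S R (y ·ᵥ A) i)
          (cong (keep S (y ·ᵥ A) i ⊕_) (keep-cong R (λ j → sym (coefs l j)) i))))
        (∙-+ˡ (keep S (y ·ᵥ A)) (keep R (coef e)) (bits α))

    lift-∩ : {α : Vec Bool n} {S : Subset n} {y : Vecₚ {p} k} {e : Eqn {p} n} (R : Subset n) →
      (∀ i → drop R (y ·ᵥ A) i ≡ 0F) → Lifts α S y e → Lifts α (S ∩ R) y e
    lift-∩ {α} {S} {y} {e} R zero-off l = mkLifts
      (λ i → trans (coefs l i) (sym (drop-∩ S R (y ·ᵥ A) zero-off i)))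
      (trans (cong (const e ⊕_) (∙-congˡ (bits α) (keep-∩ S R (y ·ᵥ A) zero-off))) (consts l))

    -- The invariant of the walk of `α` at a node labelled `L`: `Y j` lifts the equation at position
    -- `j`. The field `depends` speaks of the unrestricted lifts, which is the third condition on
    -- the pairs in the definition of robustness.
    record State (α : Vec Bool n) (L : System {p} n) : Set where
      field
        S       : Subset n
        Y       : Mat {p} (length L) k
        lifts   : ∀ j → Lifts α S (Y j) (lookup L j)
        depends : ∀ i → Vec.lookup S i ≡ true → ∃ λ j → ¬ ((Y j ·ᵥ A) i ≡ 0F)

    open State

    initial : (α : Vec Bool n) → Σ (State α (sysOf A b)) λ st → ∣ S st ∣ ≡ 0
    initial α = record
      { S = ⊥
      ; Y = unit ∘ row
      ; lifts = λ j → mkLifts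
          (λ i → trans (cong (λ e → coef e i) (row-≡ j)) (sym (trans (drop-⊥ (unit (row j) ·ᵥ A) i) (unit-∙ (row j) (λ l → A l i)))))
          (trans (cong₂ _⊕_ (cong const (row-≡ j))
              (ΣF-zero (λ i → trans (cong (_⊗ bits α i) (keep-⊥ (unit (row j) ·ᵥ A) i)) (⊗-zeroˡ (bits α i)))))
            (trans (⊕-identityʳ (b (row j))) (sym (unit-∙ (row j) b))))
      ; depends = λ i ⊥i≡true → contradiction (trans (sym (lookup-replicate i false)) ⊥i≡true) λ () } , ∣⊥∣≡0 n
      where
      row : Fin (length (sysOf A b)) → Fin k
      row j = proj₁ (∈-tabulate⁻ {f = λ i → eqn (A i) (b i)} (∈-lookup j))
      row-≡ : ∀ j → lookup (sysOf A b) j ≡ eqn (A (row j)) (b (row j))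
      row-≡ j = proj₂ (∈-tabulate⁻ {f = λ i → eqn (A i) (b i)} (∈-lookup j))

    -- An equation of `L′` is the restriction at `x` of some combination of `L`; the same
    -- combination of the old lifts lifts it over `S st ∪ ⁅ x ⁆`. Intersecting with the set `R` of
    -- variables occurring in the new lifts restores `depends` and keeps the lifts valid.
    step : {α : Vec Bool n} {L L′ : System {p} n} (x : Fin n) →
      (∀ {e} → e ∈⟨ L′ ⟩ → e ∈⟨ L ⟩↾ single x (Vec.lookup α x)) →
      (st : State α L) → Σ (State α L′) λ st′ → ∣ S st′ ∣ ≤ suc ∣ S st ∣
    step {α} {L} {L′} x inherit st = record
      { S = (S st ∪ ⁅ x ⁆) ∩ R
      ; Y = Y′
      ; lifts = λ j → lift-∩ R (zero-off j) (lifts′ j)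
      ; depends = λ i eq → depends′ i (trans (sym (lookup-zipWith _∧_ i (S st ∪ ⁅ x ⁆) R)) eq) }
      , size
      where
      Y′ : Mat {p} (length L′) k
      Y′ j = proj₁ (proj₁ (proj₂ (inherit (lookup-∈⟨⟩ L′ j)))) ·ᵥ Y st
      lifts′ : ∀ j → Lifts α (S st ∪ ⁅ x ⁆) (Y′ j) (lookup L′ j)
      lifts′ j =
        let g , (z , g≈) , g↾≈ = inherit (lookup-∈⟨⟩ L′ j)
        in lift-≈E g↾≈ (lift-restrict (single-Assigns x α) (lift-≈E g≈ (lift-lincomb L (Y st) (lifts st) z)))
      occurs? : (i : Fin n) → Dec (∃ λ j → ¬ ((Y′ j ·ᵥ A) i ≡ 0F))
      occurs? i = any? (λ j → ¬? ((Y′ j ·ᵥ A) i ≟ 0F))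
      R : Subset n
      R = Vec.tabulate (λ i → ⌊ occurs? i ⌋)
      zero-off : ∀ j i → drop R (Y′ j ·ᵥ A) i ≡ 0F
      zero-off j i rewrite lookup∘tabulate (λ i → ⌊ occurs? i ⌋) i with occurs? i
      ... | yes _ = refl
      ... | no none = decidable-stable ((Y′ j ·ᵥ A) i ≟ 0F) (λ ≢0 → none (j , ≢0))
      depends′ : ∀ i → (Vec.lookup (S st ∪ ⁅ x ⁆) i ∧ Vec.lookup R i) ≡ true → ∃ λ j → ¬ ((Y′ j ·ᵥ A) i ≡ 0F)
      depends′ i eq rewrite lookup∘tabulate (λ i → ⌊ occurs? i ⌋) i with occurs? i | Vec.lookup (S st ∪ ⁅ x ⁆) i
      ... | yes occurs | _ = occurs
      ... | no _ | true  = contradiction eq λ ()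
      ... | no _ | false = contradiction eq λ ()
      size : ∣ (S st ∪ ⁅ x ⁆) ∩ R ∣ ≤ suc ∣ S st ∣
      size = begin
        ∣ (S st ∪ ⁅ x ⁆) ∩ R ∣   ≤⟨ ∣p∩q∣≤∣p∣ (S st ∪ ⁅ x ⁆) R ⟩
        ∣ S st ∪ ⁅ x ⁆ ∣         ≤⟨ ∣p∪q∣≤∣p∣+∣q∣ (S st) ⁅ x ⁆ ⟩
        ∣ S st ∣ + ∣ ⁅ x ⁆ ∣     ≡⟨ cong (∣ S st ∣ +_) (∣⁅x⁆∣≡1 x) ⟩
        ∣ S st ∣ + 1             ≡⟨ ℕ.+-comm ∣ S st ∣ 1 ⟩
        suc ∣ S st ∣             ∎
        where open ℕ.≤-Reasoning

-- Walks through the dag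

module _ {p : ℕ} .{{_ : NonZero p}} {k n : ℕ} (A : Mat {p} k n) (b : Vecₚ {p} k) where

  open Lifts
  open State

  module _ {d : ℕ} (min-weight : (y : Vecₚ {p} k) → ¬ IsZeroVec y → d ≤ ω (y ·ᵥ A)) where

    -- Otherwise `y ·ᵥ A` would have weight at least `d` while being supported in a set of fewer
    -- than `d` coordinates. Being zero is decidable, so the argument by contradiction is
    -- constructive.
    small-support⇒zero : (S : Subset n) → ∣ S ∣ < d → (y : Vecₚ {p} k) → (∀ i → drop S (y ·ᵥ A) i ≡ 0F) → IsZeroVec y
    small-support⇒zero S ∣S∣<d y zero-off = decidable-stable (all? (λ i → y i ≟ 0F)) λ y≢0 →
      ℕ.<⇒≱ ∣S∣<d (ℕ.≤-trans (min-weight y y≢0) (ω≤∣∣ (y ·ᵥ A) S zero-off))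

    -- Outside `S ∪ R` both codewords agree with the coefficients of `e`, so the codeword of `y ⊖ z`
    -- is supported on fewer than `d` coordinates.
    lift-unique : {α β : Vec Bool n} {S R : Subset n} {y z : Vecₚ {p} k} {e : Eqn {p} n} → ∣ S ∣ + ∣ R ∣ < d →
      Lifts A b α S y e → Lifts A b β R z e → ∀ i → y i ≡ z i
    lift-unique {S = S} {R} {y} {z} {e} small l m i =
      trans (sym (⊖-⊕-cancel (y i) (z i))) (trans (cong (_⊕ z i) (w≡0 i)) (⊕-identityˡ (z i)))
      where
      w : Vecₚ {p} k
      w i = y i ⊖ z i
      wA⊕zA : ∀ i → (w ·ᵥ A) i ⊕ (z ·ᵥ A) i ≡ (y ·ᵥ A) i
      wA⊕zA i = trans (sym (∙-+ˡ w z (λ j → A j i))) (∙-congˡ (λ j → A j i) (λ j → ⊖-⊕-cancel (y j) (z j)))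
      wA-zero : ∀ i → (y ·ᵥ A) i ≡ (z ·ᵥ A) i → (w ·ᵥ A) i ≡ 0F
      wA-zero i eq = ⊕-cancelˡ ((z ·ᵥ A) i) (trans (⊕-comm ((z ·ᵥ A) i) ((w ·ᵥ A) i))
        (trans (wA⊕zA i) (trans eq (sym (⊕-identityʳ ((z ·ᵥ A) i))))))
      zero-off : ∀ i → drop (S ∪ R) (w ·ᵥ A) i ≡ 0F
      zero-off i rewrite lookup-zipWith _∨_ i S R with Vec.lookup S i | Vec.lookup R i | trans (sym (coefs l i)) (coefs m i)
      ... | true  | _     | _  = refl
      ... | false | true  | _  = refl
      ... | false | false | eq = wA-zero i eq
      w≡0 : IsZeroVec w
      w≡0 = small-support⇒zero (S ∪ R) (ℕ.≤-<-trans (∣p∪q∣≤∣p∣+∣q∣ S R) small) w zero-off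

    -- As the lifts coincide, `const e` plus the kept part at `α` and `const e` plus the kept part
    -- at `β` both equal `z ∙ b`.
    keep-∙-unique : {α β : Vec Bool n} {S R : Subset n} {y z : Vecₚ {p} k} {e : Eqn {p} n} → ∣ S ∣ + ∣ R ∣ < d →
      Lifts A b α S y e → Lifts A b β R z e → keep R (z ·ᵥ A) ∙ bits α ≡ keep R (z ·ᵥ A) ∙ bits β
    keep-∙-unique {α} {β} {S} {R} {y} {z} {e} small l m = ⊕-cancelˡ (const e) (begin
        const e ⊕ keep R (z ·ᵥ A) ∙ bits α    ≡⟨ cong (const e ⊕_) (∙-congˡ (bits α) keep≡) ⟨
        const e ⊕ keep S (y ·ᵥ A) ∙ bits α    ≡⟨ consts l ⟩
        y ∙ b                                 ≡⟨ ∙-congˡ b y≡z ⟩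
        z ∙ b                                 ≡⟨ consts m ⟨
        const e ⊕ keep R (z ·ᵥ A) ∙ bits β    ∎)
      where
      open ≡-Reasoning
      y≡z = lift-unique small l m
      -- `S` and `R` may differ, but the codewords are equal and both dropped parts equal the
      -- coefficients of `e`, so the kept parts are equal too.
      keep≡ : ∀ i → keep S (y ·ᵥ A) i ≡ keep R (z ·ᵥ A) i
      keep≡ i = ⊕-cancelˡ (coef e i) (begin
        coef e i ⊕ keep S (y ·ᵥ A) i                   ≡⟨ cong (_⊕ keep S (y ·ᵥ A) i) (coefs l i) ⟩
        drop S (y ·ᵥ A) i ⊕ keep S (y ·ᵥ A) i          ≡⟨ ⊕-comm (drop S (y ·ᵥ A) i) (keep S (y ·ᵥ A) i) ⟩
        keep S (y ·ᵥ A) i ⊕ drop S (y ·ᵥ A) i          ≡⟨ keep+drop S (y ·ᵥ A) i ⟨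
        (y ·ᵥ A) i                                     ≡⟨ ∙-congˡ (λ j → A j i) y≡z ⟩
        (z ·ᵥ A) i                                     ≡⟨ keep+drop R (z ·ᵥ A) i ⟩
        keep R (z ·ᵥ A) i ⊕ drop R (z ·ᵥ A) i          ≡⟨ ⊕-comm (keep R (z ·ᵥ A) i) (drop R (z ·ᵥ A) i) ⟩
        drop R (z ·ᵥ A) i ⊕ keep R (z ·ᵥ A) i          ≡⟨ cong (_⊕ keep R (z ·ᵥ A) i) (coefs m i) ⟨
        coef e i ⊕ keep R (z ·ᵥ A) i                   ∎)

    -- Deleting fewer than `d` columns keeps the rows of `A` independent, so the whole system with
    -- `S` fixed by `α` has a solution over the field. Every equation of `L` is a consequence of
    -- that system.
    small-state-solvable : Prime p → {α : Vec Bool n} {L : System {p} n} (st : State A b α L) → ∣ S st ∣ < d →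
      ∃ λ x → SatSys x L
    small-state-solvable pr {α} {L} st small = x , sat
      where
      open ≡-Reasoning
      A↾ : Mat {p} k n
      A↾ = drop (S st) ∘ A
      fixed : Vecₚ {p} k
      fixed i = keep (S st) (A i) ∙ bits α
      indep : LinIndep A↾
      indep y yA↾≡0 = small-support⇒zero (S st) small y (λ i → trans (drop-·ᵥ (S st) y A i) (yA↾≡0 i))
      solution = LinIndep⇒solvable pr A↾ indep (λ i → b i ⊖ fixed i)
      x = proj₁ solution
      sat-lookup : ∀ j → Sat x (lookup L j)
      sat-lookup j = ⊕-cancelˡ (y ∙ fixed) (begin
        y ∙ fixed ⊕ coef e ∙ x
          ≡⟨ cong (y ∙ fixed ⊕_) (∙-congˡ x (λ i → trans (coefs (lifts st j) i) (drop-·ᵥ (S st) y A i))) ⟩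
        y ∙ fixed ⊕ (y ·ᵥ A↾) ∙ x
          ≡⟨ cong (y ∙ fixed ⊕_) (·ᵥ-∙ y A↾ x) ⟩
        y ∙ fixed ⊕ y ∙ (λ i → A↾ i ∙ x)
          ≡⟨ ∙-+ʳ y fixed (λ i → A↾ i ∙ x) ⟨
        y ∙ (λ i → fixed i ⊕ A↾ i ∙ x)
          ≡⟨ ∙-congʳ y (λ i → trans (⊕-comm (fixed i) (A↾ i ∙ x))
               (trans (cong (_⊕ fixed i) (proj₂ solution i)) (⊖-⊕-cancel (b i) (fixed i)))) ⟩
        y ∙ b
          ≡⟨ consts (lifts st j) ⟨
        const e ⊕ keep (S st) (y ·ᵥ A) ∙ bits α
          ≡⟨ cong (const e ⊕_) (trans (∙-congˡ (bits α) (keep-·ᵥ (S st) y A)) (·ᵥ-∙ y (keep (S st) ∘ A) (bits α))) ⟩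
        const e ⊕ y ∙ fixed
          ≡⟨ ⊕-comm (const e) (y ∙ fixed) ⟩
        y ∙ fixed ⊕ const e ∎)
        where
        e = lookup L j
        y = Y st j
      sat : SatSys x L
      sat e∈L = subst (Sat x) (sym (lookup-index e∈L)) (sat-lookup (index e∈L))

    module _ (pr : Prime p) {N : ℕ} (D : BinRegDag n (sysOf A b) N) where

      open BinRegDag D

      child : (v : Fin N) (x : Fin n) (c₀ c₁ : Fin N) (v<c₀ : toℕ v < toℕ c₀) (v<c₁ : toℕ v < toℕ c₁) →
        kind v ≡ split x c₀ c₁ v<c₀ v<c₁ → (a : Bool) →
        ∃ λ c → toℕ v < toℕ c × (∀ {e} → e ∈⟨ label c ⟩ → e ∈⟨ label v ⟩↾ single x a)
      child v x c₀ c₁ v<c₀ v<c₁ kind≡ false = c₀ , v<c₀ , λ {e} → proj₁ (splitOK v x c₀ c₁ v<c₀ v<c₁ kind≡) {e}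
      child v x c₀ c₁ v<c₀ v<c₁ kind≡ true  = c₁ , v<c₁ , λ {e} → proj₂ (splitOK v x c₀ c₁ v<c₀ v<c₁ kind≡) {e}

      -- The argument f bounds the number of remaining steps.
      walk : (α : Vec Bool n) {s : ℕ} → s < d → (f : ℕ) (v : Fin N) → N ≤ toℕ v + f →
        (st : State A b α (label v)) → ∣ S st ∣ ≤ s →
        ∃ λ u → Σ (State A b α (label u)) λ st → ∣ S st ∣ ≡ s
      walk α s<d zero v fuel st small =
        contradiction (toℕ<n v) (ℕ.≤⇒≯ (subst (N ≤_) (ℕ.+-identityʳ (toℕ v)) fuel))
      walk α {s} s<d (suc f) v fuel st small with ∣ S st ∣ ℕ.≟ s
      -- Robustness asks for exactly `s` variables. The size may shrink, but it never grows by more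
      -- than one per step, so `s` cannot be skipped.
      ... | yes ≡s = v , st , ≡s
      ... | no ≢s with kind v in kind≡
      ...   | terminal =
        let x , sat = small-state-solvable pr st (ℕ.≤-<-trans small s<d)
        in contradiction (λ {e} → sat {e}) (termUnsat v kind≡ x)
      ...   | split x c₀ c₁ v<c₀ v<c₁ =
        let c , v<c , inherit = child v x c₀ c₁ v<c₀ v<c₁ kind≡ (Vec.lookup α x)
            st′ , grow = step A b x (λ {e} → inherit {e}) st
        in walk α s<d f c
             (ℕ.≤-trans fuel (ℕ.≤-trans (ℕ.≤-reflexive (ℕ.+-suc (toℕ v) f)) (ℕ.+-monoˡ-≤ f v<c)))
             st′ (ℕ.≤-trans grow (ℕ.≤∧≢⇒< small ≢s))

      stop : {s : ℕ} → s < d → (α : Vec Bool n) →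
        ∃ λ u → Σ (State A b α (label u)) λ st → ∣ S st ∣ ≡ s
      stop {s} s<d α = walk α s<d N root (ℕ.m≤n+m N (toℕ root)) (proj₁ start)
          (ℕ.≤-trans (ℕ.≤-reflexive (proj₂ start)) z≤n)
        where
        -- Generalised over `L` so that the equation `rootLab` can be matched with `refl`.
        initial-at : {L : System {p} n} → L ≡ sysOf A b → Σ (State A b α L) λ st → ∣ S st ∣ ≡ 0
        initial-at refl = initial A b α
        start = initial-at rootLab

    -- Robustness at the end of a walk

    module _ {L : System {p} n} {α : Vec Bool n} (st : State A b α L) where

      lifted : System {p} n
      lifted = tabulate (comb A b ∘ Y st)

      rows : List (Vecₚ {p} n)
      rows = map (λ g → colRestrict (assign (S st) α) (coef g)) lifted

      -- The lifted equations lie in the span of the system, their restriction by `α` on `S` is the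
      -- label `L` itself and hence 0-1 unsatisfiable, and `depends` shows that every assigned
      -- variable occurs.
      Robust⇒DimAtLeast : {s r : ℕ} → Robust A b s r → Unsat01 L → ∣ S st ∣ ≡ s → DimAtLeast rows r
      Robust⇒DimAtLeast robust unsat size = robust (assign (S st) α) lifted
          (trans (suppSize-Assigns (S st) α (λ _ → refl)) size) inherited unsat↾ hit
        where
        inherited : lifted ⊆⟨ sysOf A b ⟩
        inherited e∈ with j , refl ← ∈-tabulate⁻ {f = comb A b ∘ Y st} e∈ = comb-∈⟨⟩ A b (Y st j)
        unsat↾ : Unsat01 (restrictSys (assign (S st) α) lifted)
        unsat↾ x sat = unsat x λ e∈L → subst (Sat (bit ∘ x)) (sym (lookup-index e∈L)) (sat-lookup (index e∈L))
          where
          sat-lookup : ∀ j → Sat (bit ∘ x) (lookup L j)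
          sat-lookup j =
            let c≡ , d≡ = restrict-comb A b (lifts st j)
            in trans (∙-congˡ (bit ∘ x) (λ i → sym (c≡ i)))
                 (trans (sat (∈-map⁺ (restrict (assign (S st) α)) (∈-tabulate⁺ {f = comb A b ∘ Y st} j))) d≡)
        hit : DependsOnSupp (assign (S st) α) lifted
        hit i a eq with Vec.lookup (S st) i in Si≡
        ... | true =
          let j , ≢0 = depends st i Si≡
          in comb A b (Y st j) , ∈-tabulate⁺ {f = comb A b ∘ Y st} j , ≢0

      -- The rows come from the reference state `st` alone. Any other assignment that reaches the
      -- same label must therefore satisfy the same equations, with the values at `α` as right-hand
      -- sides.
      row-∙-unique : {β : Vec Bool n} (st′ : State A b β L) → ∣ S st′ ∣ + ∣ S st ∣ < d →
        ∀ {u} → u ∈ rows → u ∙ bits β ≡ u ∙ bits α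
      row-∙-unique {β} st′ small u∈
        with g , g∈ , refl ← ∈-map⁻ (λ g → colRestrict (assign (S st) α) (coef g)) u∈
        with j , refl ← ∈-tabulate⁻ {f = comb A b ∘ Y st} g∈ =
        trans (∙-congˡ (bits β) keep≡)
          (trans (keep-∙-unique small (lifts st′ j) (lifts st j)) (sym (∙-congˡ (bits α) keep≡)))
        where
        keep≡ : ∀ i → colRestrict (assign (S st) α) (Y st j ·ᵥ A) i ≡ keep (S st) (Y st j ·ᵥ A) i
        keep≡ = colRestrict-keep {S = S st} {α} (λ _ → refl) (Y st j ·ᵥ A)

      span-∙-unique : {β : Vec Bool n} (st′ : State A b β L) → ∣ S st′ ∣ + ∣ S st ∣ < d →
        ∀ {u} → InRowSpan u rows → u ∙ bits β ≡ u ∙ bits α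
      span-∙-unique {β} st′ small {u} (z , z·rows≡u) = begin
        u ∙ bits β                               ≡⟨ ∙-congˡ (bits β) z·rows≡u ⟨
        (z ·ᵥ lookup rows) ∙ bits β              ≡⟨ ·ᵥ-∙ z (lookup rows) (bits β) ⟩
        z ∙ (λ l → lookup rows l ∙ bits β)       ≡⟨ ∙-congʳ z (λ l → row-∙-unique st′ small (∈-lookup l)) ⟩
        z ∙ (λ l → lookup rows l ∙ bits α)       ≡⟨ ·ᵥ-∙ z (lookup rows) (bits α) ⟨
        (z ·ᵥ lookup rows) ∙ bits α              ≡⟨ ∙-congˡ (bits α) z·rows≡u ⟩
        u ∙ bits α                               ∎
        where open ≡-Reasoning

    2^r≤size : Prime p → {s r : ℕ} → Robust A b s r → 2 * s < d → {N : ℕ} → BinRegDag n (sysOf A b) N → 2 ^ r ≤ N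
    2^r≤size pr {s} {r} robust 2s<d {N} D = fibres-bound end (2 ^ r) bound
      where
      open BinRegDag D
      s<d : s < d
      s<d = ℕ.≤-<-trans (ℕ.m≤m+n s (s + 0)) 2s<d
      end : Vec Bool n → Fin N
      end α = proj₁ (stop pr D s<d α)
      end-state : {α : Vec Bool n} {v : Fin N} → T ⌊ end α ≟ v ⌋ → Σ (State A b α (label v)) λ st → ∣ S st ∣ ≡ s
      end-state {α} {v} eq = subst (λ v → Σ (State A b α (label v)) λ st → ∣ S st ∣ ≡ s) (toWitness eq)
        (proj₂ (stop pr D s<d α))
      bound : ∀ v → 2 ^ r * count (λ α → ⌊ end α ≟ v ⌋) ≤ 2 ^ n
      bound v with count≡0⊎∃ (λ α → ⌊ end α ≟ v ⌋)
      ... | inj₁ empty = ℕ.≤-trans (ℕ.≤-reflexive (trans (cong (2 ^ r *_) empty) (ℕ.*-zeroʳ (2 ^ r)))) z≤n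
      -- A nonempty fibre provides a reference assignment `α`. Robustness at its state gives `r`
      -- independent forms, and each `β` of the fibre takes the values of `α` on them.
      ... | inj₂ (α , end≡v) =
        let st , size = end-state end≡v
            u , indep , spans = Robust⇒DimAtLeast st robust (unsat01 v) size
        in count-solutions pr u indep (λ i → u i ∙ bits α) (λ β → ⌊ end β ≟ v ⌋) λ β β↦v i →
             let st′ , size′ = end-state β↦v
             in span-∙-unique st st′ (ℕ.≤-<-trans (ℕ.≤-reflexive (cong₂ _+_ size′ (trans size (sym (ℕ.+-identityʳ s))))) 2s<d)
                  (spans i)

theorem5p7 : Σ ℕ λ m → Σ ℕ λ q → (1 ≤ m) × (1 ≤ q) ×
    ((p : ℕ) → .{{_ : NonZero p}} → Prime p → 5 ≤ p →
    (n k d s r : ℕ) → (A : Mat {p} k n) → (b : Vecₚ {p} k) →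
    HasRank A k → Distance A d → Unsat01 (sysOf A b) →
    Robust A b s r → 2 * s < d →
    (N : ℕ) → BinRegDag n (sysOf A b) N →
    2 ^ (m * r) ≤ N ^ q)
-- The constant of the exponent is the ratio of the first two components, so the size is at least
-- `2 ^ r` with c = 1.
theorem5p7 = 1 , 1 , ℕ.≤-refl , ℕ.≤-refl ,
  λ p pr _ n k d s r A b _ (_ , min-weight) _ robust 2s<d N D →
    subst₂ _≤_ (cong (2 ^_) (sym (ℕ.*-identityˡ r))) (sym (ℕ.*-identityʳ N))
      (2^r≤size A b min-weight pr robust 2s<d D)
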